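{- Let $G$ be a cyclically 6-edge-connected cubic graph. If $\mu_2(G) \leq 2$, then $G$ has a nowhere-zero 5-flow.
   Context: A cubic graph is a graph all of whose vertices have degree 3 (graphs are finite). A graph is cyclically $k$-edge-connected if it has no edge cut $E$ with fewer than $k$ edges such that two components of $G-E$ contain circuits. A 1-factor of $G$ is a perfect matching, regarded as a set of edges. For a bridgeless cubic graph $G$, $\mu_2(G) = \min\{|M_1 \cap M_2| : M_1 \text{ and } M_2 \text{ are 1-factors of } G\}$ (1-factors exist by Petersen's theorem). A nowhere-zero $k$-flow on $G$ is an assignment of a direction and a value from $\{1,\dots,k-1\}$ to each edge of $G$ such that Kirchhoff's law holds at every vertex (the sum of the values on incoming edges equals the sum of the values on outgoing edges). -}

module Defs where

open import Data.Bool.Base using (Bool; if_then_else_)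
open import Data.Fin.Base using (Fin)
open import Data.Fin.Properties using (_≟_)
open import Data.Fin.Subset using (Subset; _∈_; ⊤; ∁; _∩_; ∣_∣)
open import Data.List.Base using (List; []; _∷_)
open import Data.List.Relation.Unary.All using (All)
open import Data.List.Relation.Unary.Unique.Propositional using (Unique)
open import Data.Nat.Base using (ℕ; _+_; _≤_; _<_)
open import Data.Nat.Properties using (+-0-commutativeMonoid)
open import Data.Product.Base using (_×_; _,_; proj₁; proj₂; ∃; ∃-syntax)
open import Data.Sum.Base using (_⊎_)
open import Data.Vec.Base using (lookup)
open import Relation.Binary.PropositionalEquality using (_≡_; _≢_)
open import Relation.Nullary using (¬_; does)
open import Relation.Unary using (Pred)
open import Algebra.Properties.CommutativeMonoid.Sum +-0-commutativeMonoid
  using (sum-syntax)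
open import Level using (0ℓ)

-- Finite undirected graphs; parallel edges and loops are allowed.  The order
-- of the two ends of an edge carries no meaning of its own: it only serves as
-- a reference for choosing directions in flows.
record Graph : Set where
  field
    order : ℕ
    size  : ℕ
    ends  : Fin size → Fin order × Fin order

  Vertex : Set
  Vertex = Fin order

  Edge : Set
  Edge = Fin size

δ : ∀ {n} → Fin n → Fin n → ℕ
δ u v = if does (u ≟ v) then 1 else 0

module _ (G : Graph) where
  open Graph G

  -- Degree of v in the spanning subgraph with edge set F.  A loop at v
  -- contributes 2.
  degree : Subset size → Vertex → ℕ
  degree F v = ∑[ e < size ]
    (if lookup F e then δ (proj₁ (ends e)) v + δ (proj₂ (ends e)) v else 0)

  Cubic : Set
  Cubic = ∀ v → degree ⊤ v ≡ 3

  OneFactor : Subset size → Set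
  OneFactor M = ∀ v → degree M v ≡ 1

  -- k is the size of the intersection of some pair of (possibly equal)
  -- 1-factors.
  IntersectionSize : ℕ → Set
  IntersectionSize k =
    ∃[ M₁ ] ∃[ M₂ ] OneFactor M₁ × OneFactor M₂ × ∣ M₁ ∩ M₂ ∣ ≡ k

  -- The relation "μ₂(G) = k".  It determines k uniquely, and no value has to
  -- be invented for graphs without 1-factors.
  Isμ₂ : ℕ → Set
  Isμ₂ k = IntersectionSize k × (∀ j → IntersectionSize j → k ≤ j)

  Joins : Edge → Vertex → Vertex → Set
  Joins e u v = ends e ≡ (u , v) ⊎ ends e ≡ (v , u)

  data Walk (F : Subset size) : Vertex → Vertex → Set where
    stop : ∀ {u} → Walk F u u
    step : ∀ {u v w} (e : Edge) → e ∈ F → Joins e u v → Walk F v w → Walk F u w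

  walkEdges : ∀ {F u v} → Walk F u v → List Edge
  walkEdges stop           = []
  walkEdges (step e _ _ p) = e ∷ walkEdges p

  -- All vertices of the walk except its last one, so that a closed walk lists
  -- its base point once.
  walkVertices : ∀ {F u v} → Walk F u v → List Vertex
  walkVertices stop                   = []
  walkVertices (step {u = u} _ _ _ p) = u ∷ walkVertices p

  -- Distinctness of the edges matters only for length 2, where it excludes
  -- going back and forth along a single edge.
  record Circuit (F : Subset size) : Set where
    field
      base             : Vertex
      walk             : Walk F base base
      nonempty         : walkEdges walk ≢ []
      distinctEdges    : Unique (walkEdges walk)
      distinctVertices : Unique (walkVertices walk)

  -- The vertex set of the component containing u of the spanning subgraph with
  -- edge set F.  The components of u and v differ iff  ¬ Walk F u v.
  component : Subset size → Vertex → Pred Vertex 0ℓ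
  component F u v = Walk F u v

  ContainsCircuit : Subset size → Pred Vertex 0ℓ → Set
  ContainsCircuit F C = ∃ λ (c : Circuit F) → All C (walkVertices (Circuit.walk c))

  -- X is an edge cut iff G − X is disconnected; the edge set of G − X is ∁ X.
  EdgeCut : Subset size → Set
  EdgeCut X = ∃[ u ] ∃[ v ] ¬ Walk (∁ X) u v

  TwoComponentsContainCircuits : Subset size → Set
  TwoComponentsContainCircuits F = ∃[ u ] ∃[ v ]
    ¬ Walk F u v × ContainsCircuit F (component F u) × ContainsCircuit F (component F v)

  CyclicallyEdgeConnected : ℕ → Set
  CyclicallyEdgeConnected k =
    ¬ (∃[ X ] EdgeCut X × ∣ X ∣ < k × TwoComponentsContainCircuits (∁ X))

  -- An orientation directs e from the first to the second of its ends iff it is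
  -- true at e.
  Orientation : Set
  Orientation = Edge → Bool

  tail head : Orientation → Edge → Vertex
  tail d e = if d e then proj₁ (ends e) else proj₂ (ends e)
  head d e = if d e then proj₂ (ends e) else proj₁ (ends e)

  inflow outflow : Orientation → (Edge → ℕ) → Vertex → ℕ
  inflow  d f v = ∑[ e < size ] (if does (head d e ≟ v) then f e else 0)
  outflow d f v = ∑[ e < size ] (if does (tail d e ≟ v) then f e else 0)

  record NowhereZeroFlow (k : ℕ) : Set where
    field
      direction : Orientation
      value     : Edge → ℕ
      value≥1   : ∀ e → 1 ≤ value e
      value<k   : ∀ e → value e < k
      kirchhoff : ∀ v → inflow direction value v ≡ outflow direction value v

{-# OPTIONS --safe #-}
module Submission where

-- Two 1-factors M₁, M₂ give a flow f = 2g + h with |f| ≤ 3 that vanishes exactly on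
-- M₁ ∩ M₂: g and h are ±1-flows on the even subgraphs E ∖ M₁ and M₁ Δ M₂, so f = ±2
-- outside M₁ ∪ M₂.  Orient the edges along f, and the at most two edges of M₁ ∩ M₂
-- arbitrarily.  By Hoffman's theorem this orientation carries a flow with values in
-- {1,…,4} unless some cut X has P leaving and Q entering edges outside M₁ ∩ M₂ with
-- 4P - Q too small.  As Q ≤ 3P and P ≥ 1, this forces P = 1, Q = 3, and both edges
-- e₁, e₂ of M₁ ∩ M₂ to enter X; moreover f is odd on the cut.
--
-- If all four ways to orient e₁ and e₂ fail, uncross the violating sets of two
-- orientations that agree on e₁: since 4P - Q is submodular, their intersection and
-- their union are again cuts with P = 1 and Q = 3, crossed by e₁ but not by e₂, hence
-- cuts of 5 edges.  A vertex set that induces a forest and has a cut of 5 edges has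
-- at most 3 vertices, so cyclic 6-edge-connectivity bounds the intersection A of one
-- pair and the complement A′ of the union of the other pair, both containing the
-- same end of e₁.  Edges outside M₁ ∪ M₂ cross neither, which makes A ∩ A′ have at
-- least 3 vertices.  So A = A′, but A has 3 entering edges and A′ only one.

open import Defs
open import Data.Bool.Base using (Bool; true; false; _∧_; _∨_; _xor_; not; if_then_else_)
open import Data.Bool.Properties as Bool using ()
open import Data.Empty using (⊥; ⊥-elim)
open import Data.Fin.Base using (Fin; zero; suc)
open import Data.Fin.Properties as Fin using (_≟_; any?)
open import Data.Fin.Subset using (Subset; ⊤; ∁; _∩_) renaming (∣_∣ to ∣_∣ₛ; _∈_ to _∈ₛ_)
open import Data.Integer.Base hiding (suc)
open import Data.Integer.Properties as ℤ
  using (≤-refl; ≤-trans; ≤-reflexive; ≤-antisym; +-mono-≤; +-*-semiring)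
open import Data.Integer.Tactic.RingSolver using (solve-∀)
open import Data.List.Base as List using (List; []; _∷_; length)
open import Data.List.Membership.Propositional using (_∈_; _∉_)
open import Data.List.Membership.Propositional.Properties using (∈-lookup)
open import Data.List.Relation.Unary.All as All using (All; []; _∷_)
open import Data.List.Relation.Unary.AllPairs using ([]; _∷_)
open import Data.List.Relation.Unary.Any as Any using (here; there)
open import Data.List.Relation.Unary.Unique.Propositional using (Unique)
open import Data.Nat.Base as ℕ using (ℕ; zero; suc; z≤n; s≤s)
open import Data.Nat.Properties as ℕ using ()
open import Data.Product.Base using (_×_; _,_; proj₁; proj₂; ∃; ∃-syntax)
open import Data.Sum.Base as Sum using (_⊎_; inj₁; inj₂; [_,_]′)
open import Data.Vec.Base using (lookup; tabulate; []; _∷_)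
open import Data.Vec.Properties
  using (lookup∘tabulate; lookup⇒[]=; []=⇒lookup; lookup-map; lookup-replicate; lookup-zipWith)
open import Function.Base using (_∘_; id)
open import Relation.Binary.PropositionalEquality
open import Relation.Nullary using (¬_; Dec; yes; no; does; contradiction; _×-dec_; _→-dec_; from-yes)
open import Algebra.Properties.CommutativeMonoid.Sum ℕ.+-0-commutativeMonoid as ℕ-Sum using ()
open import Algebra.Properties.Semiring.Sum +-*-semiring
  using (sum; sum-cong-≗; ∑-distrib-+; ∑-comm; *-distribˡ-sum)

-- Indicators and finite sums of integers

⟦_⟧ : Bool → ℤ
⟦ b ⟧ = if b then 1ℤ else 0ℤ

infix 7 _==_
_==_ : ∀ {n} → Fin n → Fin n → Bool
u == v = does (u ≟ v)

==-refl : ∀ {n} (u : Fin n) → u == u ≡ true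
==-refl u with u ≟ u
... | yes _  = refl
... | no u≢u = contradiction refl u≢u

==⇒≡ : ∀ {n} {u v : Fin n} → u == v ≡ true → u ≡ v
==⇒≡ {u = u} {v} eq with u ≟ v
... | yes u≡v = u≡v
==⇒≡ () | no _

suc-== : ∀ {n} (u v : Fin n) → suc u == suc v ≡ u == v
suc-== u v with u ≟ v
... | yes _ = refl
... | no _  = refl

opaque

  -- Opaque, so that every sum stays an atom in the ring identities that carry the linear arithmetic
  -- of the proof.
  ∑ : ∀ {n} → (Fin n → ℤ) → ℤ
  ∑ = sum

  ∑-zero : ∀ (f : Fin 0 → ℤ) → ∑ f ≡ 0ℤ
  ∑-zero f = refl

  ∑-suc : ∀ {n} (f : Fin (suc n) → ℤ) → ∑ f ≡ f zero + ∑ (λ i → f (suc i))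
  ∑-suc f = refl

  ∑-cong : ∀ {n} {f g : Fin n → ℤ} → (∀ i → f i ≡ g i) → ∑ f ≡ ∑ g
  ∑-cong = sum-cong-≗

  ∑-+ : ∀ {n} (f g : Fin n → ℤ) → ∑ (λ i → f i + g i) ≡ ∑ f + ∑ g
  ∑-+ = ∑-distrib-+

  ∑-* : ∀ {n} a (f : Fin n → ℤ) → ∑ (λ i → a * f i) ≡ a * ∑ f
  ∑-* a f = sym (*-distribˡ-sum a f)

  ∑-swap : ∀ {m n} (f : Fin m → Fin n → ℤ) → ∑ (λ i → ∑ (f i)) ≡ ∑ (λ j → ∑ (λ i → f i j))
  ∑-swap = ∑-comm

  ∑-mono : ∀ {n} {f g : Fin n → ℤ} → (∀ i → f i ≤ g i) → ∑ f ≤ ∑ g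
  ∑-mono {zero}  f≤g = ≤-refl
  ∑-mono {suc n} f≤g = +-mono-≤ (f≤g zero) (∑-mono (λ i → f≤g (suc i)))

∑-minus : ∀ {n} (f g : Fin n → ℤ) → ∑ (λ i → f i - g i) ≡ ∑ f - ∑ g
∑-minus f g = begin
  ∑ (λ i → f i - g i)         ≡⟨ ∑-cong (λ i → cong (_+_ (f i)) (sym (ℤ.-1*i≡-i (g i)))) ⟩
  ∑ (λ i → f i + -1ℤ * g i)   ≡⟨ ∑-+ f _ ⟩
  ∑ f + ∑ (λ i → -1ℤ * g i)   ≡⟨ cong (_+_ (∑ f)) (∑-* -1ℤ g) ⟩
  ∑ f + -1ℤ * ∑ g             ≡⟨ cong (_+_ (∑ f)) (ℤ.-1*i≡-i (∑ g)) ⟩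
  ∑ f - ∑ g                   ∎
  where open ≡-Reasoning

∑-0 : ∀ {n} {f : Fin n → ℤ} → (∀ i → f i ≡ 0ℤ) → ∑ f ≡ 0ℤ
∑-0 {f = f} f≗0 = trans (∑-cong (λ i → trans (f≗0 i) (sym (ℤ.*-zeroˡ (f i))))) (∑-* 0ℤ f)

∑-nonneg : ∀ {n} {f : Fin n → ℤ} → (∀ i → 0ℤ ≤ f i) → 0ℤ ≤ ∑ f
∑-nonneg {n} {f} 0≤f = subst (_≤ ∑ f) (∑-0 {n} (λ _ → refl)) (∑-mono 0≤f)

∑-pick : ∀ {n} (g : Fin n → ℤ) u → ∑ (λ v → g v * ⟦ u == v ⟧) ≡ g u
∑-pick g zero = trans (∑-suc _)
  (trans (cong₂ _+_ (ℤ.*-identityʳ (g zero)) (∑-0 (λ i → ℤ.*-zeroʳ (g (suc i))))) (ℤ.+-identityʳ _))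
∑-pick g (suc u) = trans (∑-suc _) (trans (cong₂ _+_ (ℤ.*-zeroʳ (g zero))
    (trans (∑-cong (λ i → cong (λ b → g (suc i) * ⟦ b ⟧) (suc-== u i))) (∑-pick (λ i → g (suc i)) u)))
  (ℤ.+-identityˡ _))

∑-δ : ∀ {n} (u : Fin n) → ∑ (λ v → ⟦ u == v ⟧) ≡ 1ℤ
∑-δ u = trans (∑-cong (λ v → sym (ℤ.*-identityˡ _))) (∑-pick (λ _ → 1ℤ) u)

term≤∑ : ∀ {n} {f : Fin n → ℤ} → (∀ i → 0ℤ ≤ f i) → ∀ i → f i ≤ ∑ f
term≤∑ {f = f} 0≤f i = subst (_≤ ∑ f) (∑-pick f i) (∑-mono below)
  where
  below : ∀ j → f j * ⟦ i == j ⟧ ≤ f j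
  below j with i ≟ j
  ... | yes _ = ≤-reflexive (ℤ.*-identityʳ (f j))
  ... | no _  = subst (_≤ f j) (sym (ℤ.*-zeroʳ (f j))) (0≤f j)

term-zero : ∀ {n} {f : Fin n → ℤ} → (∀ i → 0ℤ ≤ f i) → ∑ f ≤ 0ℤ → ∀ i → f i ≡ 0ℤ
term-zero 0≤f s≤0 i = ≤-antisym (≤-trans (term≤∑ 0≤f i) s≤0) (0≤f i)

-- Linear combinations of functions, so that an inequality between sums can be
-- reduced to its summands.
Combination : ℕ → Set
Combination n = List (ℤ × (Fin n → ℤ))

at : ∀ {n} → Combination n → Fin n → ℤ
at []            i = 0ℤ
at ((a , f) ∷ c) i = a * f i + at c i

total : ∀ {n} → Combination n → ℤ
total []            = 0ℤ
total ((a , f) ∷ c) = a * ∑ f + total c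

sum-at : ∀ {n} (c : Combination n) → ∑ (at c) ≡ total c
sum-at []            = ∑-0 (λ _ → refl)
sum-at ((a , f) ∷ c) =
  trans (∑-+ (λ i → a * f i) (at c)) (cong₂ _+_ (∑-* a f) (sum-at c))

total-nonneg : ∀ {n} (c : Combination n) → (∀ i → 0ℤ ≤ at c i) → 0ℤ ≤ total c
total-nonneg c 0≤c = subst (0ℤ ≤_) (sum-at c) (∑-nonneg 0≤c)

-- The equality case: an inequality between sums that turns out to be tight is tight in each
-- summand. This is how a count over a whole cut yields information about single edges.
at-zero : ∀ {n} (c : Combination n) → (∀ i → 0ℤ ≤ at c i) → total c ≤ 0ℤ → ∀ i → at c i ≡ 0ℤ
at-zero c 0≤c c≤0 = term-zero 0≤c (subst (_≤ 0ℤ) (sym (sum-at c)) c≤0)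

-- Flows and their net outflow

push : ∀ {m n} → (Fin m → Fin n) → (Fin m → ℤ) → Fin n → ℤ
push {m} t x v = ∑ (λ e → x e * ⟦ t e == v ⟧)

push-pairing : ∀ {m n} (t : Fin m → Fin n) x (g : Fin n → ℤ) →
  ∑ (λ v → g v * push t x v) ≡ ∑ (λ e → x e * g (t e))
push-pairing {m} {n} t x g = begin
  ∑ (λ v → g v * push t x v)                       ≡⟨ ∑-cong (λ v → sym (∑-* (g v) _)) ⟩
  ∑ (λ v → ∑ (λ e → g v * (x e * ⟦ t e == v ⟧))) ≡⟨ ∑-swap _ ⟩
  ∑ (λ e → ∑ (λ v → g v * (x e * ⟦ t e == v ⟧))) ≡⟨ ∑-cong (λ e → ∑-cong (λ v → rearr (g v) (x e) _)) ⟩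
  ∑ (λ e → ∑ (λ v → x e * g v * ⟦ t e == v ⟧))   ≡⟨ ∑-cong (λ e → ∑-pick (λ v → x e * g v) (t e)) ⟩
  ∑ (λ e → x e * g (t e))                          ∎
  where
  open ≡-Reasoning
  rearr : ∀ a b c → a * (b * c) ≡ b * a * c
  rearr = solve-∀

push-cong : ∀ {m n} (t : Fin m → Fin n) {x y} → (∀ e → x e ≡ y e) → ∀ v → push t x v ≡ push t y v
push-cong t x≗y v = ∑-cong (λ e → cong (_* ⟦ t e == v ⟧) (x≗y e))

push-lin : ∀ {m n} (t : Fin m → Fin n) a x b y v →
  push t (λ e → a * x e + b * y e) v ≡ a * push t x v + b * push t y v
push-lin t a x b y v =
  trans (∑-cong (λ e → rearr a (x e) b (y e) ⟦ t e == v ⟧))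
  (trans (∑-+ (λ e → a * (x e * ⟦ t e == v ⟧)) (λ e → b * (y e * ⟦ t e == v ⟧)))
    (cong₂ _+_ (∑-* a _) (∑-* b _)))
  where
  rearr : ∀ a x b y c → (a * x + b * y) * c ≡ a * (x * c) + b * (y * c)
  rearr = solve-∀

push-δ : ∀ {m n} (t : Fin m → Fin n) e v → push t (λ e′ → ⟦ e == e′ ⟧) v ≡ ⟦ t e == v ⟧
push-δ t e v = trans (∑-cong (λ e′ → ℤ.*-comm ⟦ e == e′ ⟧ _)) (∑-pick (λ e′ → ⟦ t e′ == v ⟧) e)

module Circulation {m n : ℕ} (t h : Fin m → Fin n) where

  net : (Fin m → ℤ) → Fin n → ℤ
  net x v = push t x v - push h x v

  net-lin : ∀ a x b y v → net (λ e → a * x e + b * y e) v ≡ a * net x v + b * net y v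
  net-lin a x b y v = trans (cong₂ _-_ (push-lin t a x b y v) (push-lin h a x b y v)) (rearr a b _ _ _ _)
    where
    rearr : ∀ a b p q r s → a * p + b * q - (a * r + b * s) ≡ a * (p - r) + b * (q - s)
    rearr = solve-∀

  -- Summation by parts. With `g` the indicator of a vertex set, the right side is the net flow
  -- across its boundary: only crossing edges count, positively if they leave the set.
  net-pairing : ∀ x (g : Fin n → ℤ) →
    ∑ (λ v → g v * net x v) ≡ ∑ (λ e → x e * (g (t e) - g (h e)))
  net-pairing x g = begin
    ∑ (λ v → g v * net x v)                                ≡⟨ ∑-cong (λ v → dist (g v) _ _) ⟩
    ∑ (λ v → g v * push t x v - g v * push h x v)          ≡⟨ ∑-minus _ _ ⟩
    ∑ (λ v → g v * push t x v) - ∑ (λ v → g v * push h x v) ≡⟨ cong₂ _-_ (push-pairing t x g) (push-pairing h x g) ⟩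
    ∑ (λ e → x e * g (t e)) - ∑ (λ e → x e * g (h e))   ≡⟨ ∑-minus _ _ ⟨
    ∑ (λ e → x e * g (t e) - x e * g (h e))                ≡⟨ ∑-cong (λ e → dist (x e) _ _) ⟨
    ∑ (λ e → x e * (g (t e) - g (h e)))                    ∎
    where
    open ≡-Reasoning
    dist : ∀ a b c → a * (b - c) ≡ a * b - a * c
    dist = solve-∀

  sum-net : ∀ x → ∑ (λ v → net x v) ≡ 0ℤ
  sum-net x = trans (∑-cong (λ v → sym (ℤ.*-identityˡ _)))
    (trans (net-pairing x (λ _ → 1ℤ)) (∑-0 (λ e → ℤ.*-zeroʳ (x e))))

-- Inequalities as nonnegative gaps

infixl 6 _⊞_
-- Linear arithmetic: hypotheses become nonnegative gaps, are added up (repeatedly, if a coefficient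
-- above 1 is needed), and `by` turns the sum into the gap of the goal by a ring identity.
-- Contradictory hypotheses are made to add up to -1.
_⊞_ : ∀ {a b} → 0ℤ ≤ a → 0ℤ ≤ b → 0ℤ ≤ a + b
_⊞_ = +-mono-≤

by : ∀ {a b} → a ≡ b → 0ℤ ≤ a → 0ℤ ≤ b
by = subst (0ℤ ≤_)

gap : ∀ {a b} → a ≤ b → 0ℤ ≤ b - a
gap = ℤ.i≤j⇒0≤j-i

ungap : ∀ {a b} → 0ℤ ≤ b - a → a ≤ b
ungap = ℤ.0≤i-j⇒j≤i

strict-gap : ∀ {a b} → a < b → 0ℤ ≤ b - a - 1ℤ
strict-gap {a} {b} a<b = by (lemma a b) (gap (ℤ.i<j⇒suc[i]≤j a<b))
  where
  lemma : ∀ a b → b - (1ℤ + a) ≡ b - a - 1ℤ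
  lemma = solve-∀

0≰-1 : ¬ (0ℤ ≤ -1ℤ)
0≰-1 ()

⟦⟧-nonneg : ∀ b → 0ℤ ≤ ⟦ b ⟧
⟦⟧-nonneg false = +≤+ z≤n
⟦⟧-nonneg true  = +≤+ z≤n

-- The circulation theorem of Hoffman

module Hoffman {m n : ℕ} (t h : Fin m → Fin n) (lo hi : Fin m → ℤ) (b : Fin n → ℤ) where
  open Circulation t h

  Bounded : (Fin m → ℤ) → Set
  Bounded x = ∀ e → lo e ≤ x e × x e ≤ hi e

  -- Summed over the edges, the largest net flow out of `X` that the bounds permit.
  capacity : (Fin n → Bool) → Fin m → ℤ
  capacity X e =
    if X (t e) then (if X (h e) then 0ℤ else hi e) else (if X (h e) then - lo e else 0ℤ)

  Feasible : Set
  Feasible = ∃[ x ] Bounded x × (∀ v → net x v ≡ b v)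

  Violated : Set
  Violated = ∃[ X ] ∑ (capacity X) < ∑ (λ v → ⟦ X v ⟧ * b v)

  module _ (x : Fin m → ℤ) (x-bounded : Bounded x) (s : Fin n) where

    Inside : (Fin n → Bool) → Fin m → Bool
    Inside S e = S (t e) ∧ S (h e)

    -- One unit of flow can be sent from s to w.  Keeping x unchanged on the
    -- edges leaving S makes it possible to enlarge S by one edge without
    -- keeping track of augmenting paths.
    Reach : (Fin n → Bool) → Fin n → Set
    Reach S w = ∃[ y ] Bounded y
      × (∀ v → net y v ≡ net x v + (⟦ s == v ⟧ - ⟦ w == v ⟧))
      × (∀ e → Inside S e ≡ false → y e ≡ x e)

    -- No edge of the residual graph of `x` leaves `S`, neither one with room below `hi` nor a
    -- reversed one with room above `lo`.
    Closed : (Fin n → Bool) → Set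
    Closed S = (∀ e → ¬ (S (t e) ≡ true × S (h e) ≡ false × x e < hi e))
             × (∀ e → ¬ (S (t e) ≡ false × S (h e) ≡ true × lo e < x e))

    insert : (Fin n → Bool) → Fin n → Fin n → Bool
    insert S w v = S v ∨ w == v

    insert-new : ∀ S w → insert S w w ≡ true
    insert-new S w rewrite ==-refl w = Bool.∨-zeroʳ (S w)

    insert-old : ∀ S w {v} → S v ≡ true → insert S w v ≡ true
    insert-old S w Sv rewrite Sv = refl

    outside-insert : ∀ S w e → Inside (insert S w) e ≡ false → Inside S e ≡ false
    outside-insert S w e out with S (t e) | S (h e)
    ... | true  | true  = out
    ... | true  | false = refl
    ... | false | _     = refl

    -- The new vertex `w` is reached by routing the unit to `u` and then changing `e₀` by `k`, which
    -- is 1 along the edge and -1 against it. Rerouting inside `S` has not touched `e₀`, so the room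
    -- that `x` leaves there is still available.
    extend : ∀ S {u w} e₀ k → S u ≡ true → Inside S e₀ ≡ false → Inside (insert S w) e₀ ≡ true →
      lo e₀ ≤ x e₀ + k → x e₀ + k ≤ hi e₀ →
      (∀ v → k * (⟦ t e₀ == v ⟧ - ⟦ h e₀ == v ⟧) ≡ ⟦ u == v ⟧ - ⟦ w == v ⟧) →
      (∀ w′ → S w′ ≡ true → Reach S w′) → ∀ w′ → insert S w w′ ≡ true → Reach (insert S w) w′
    extend S {u} {w} e₀ k Su out₀ in₀ lo≤ ≤hi k-net reach w′ w′∈ with S w′ in Sw′
    ... | true =
      let y , y-bounded , y-net , y-out = reach w′ Sw′
      in y , y-bounded , y-net , λ e out → y-out e (outside-insert S w e out)
    ... | false with ==⇒≡ {u = w} w′∈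
    ... | refl = y′ , y′-bounded , y′-net , y′-out
      where
      y = proj₁ (reach u Su)
      y-bounded = proj₁ (proj₂ (reach u Su))
      y-net = proj₁ (proj₂ (proj₂ (reach u Su)))
      y-out = proj₂ (proj₂ (proj₂ (reach u Su)))
      y′ : Fin m → ℤ
      y′ e = 1ℤ * y e + k * ⟦ e₀ == e ⟧
      y′-e₀ : x e₀ + k ≡ 1ℤ * y e₀ + k * ⟦ true ⟧
      y′-e₀ rewrite y-out e₀ out₀ = lemma (x e₀) k
        where
        lemma : ∀ a k → a + k ≡ 1ℤ * a + k * 1ℤ
        lemma = solve-∀
      y′-other : ∀ e → y e ≡ 1ℤ * y e + k * ⟦ false ⟧
      y′-other e = lemma (y e) k
        where
        lemma : ∀ a k → a ≡ 1ℤ * a + k * 0ℤ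
        lemma = solve-∀
      y′-bounded : Bounded y′
      y′-bounded e with e₀ ≟ e
      ... | yes refl = subst (lo e ≤_) y′-e₀ lo≤ , subst (_≤ hi e) y′-e₀ ≤hi
      ... | no _     = subst (lo e ≤_) (y′-other e) (proj₁ (y-bounded e))
                     , subst (_≤ hi e) (y′-other e) (proj₂ (y-bounded e))
      y′-net : ∀ v → net y′ v ≡ net x v + (⟦ s == v ⟧ - ⟦ w == v ⟧)
      y′-net v = begin
        net y′ v                                        ≡⟨ net-lin 1ℤ y k _ v ⟩
        1ℤ * net y v + k * net (λ e → ⟦ e₀ == e ⟧) v    ≡⟨ cong₂ (λ p q → 1ℤ * p + k * q) (y-net v) (cong₂ _-_ (push-δ t e₀ v) (push-δ h e₀ v)) ⟩
        1ℤ * (net x v + (⟦ s == v ⟧ - ⟦ u == v ⟧)) + k * (⟦ t e₀ == v ⟧ - ⟦ h e₀ == v ⟧)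
                                                        ≡⟨ cong (_+_ (1ℤ * (net x v + (⟦ s == v ⟧ - ⟦ u == v ⟧)))) (k-net v) ⟩
        1ℤ * (net x v + (⟦ s == v ⟧ - ⟦ u == v ⟧)) + (⟦ u == v ⟧ - ⟦ w == v ⟧)
                                                        ≡⟨ lemma (net x v) ⟦ s == v ⟧ ⟦ u == v ⟧ ⟦ w == v ⟧ ⟩
        net x v + (⟦ s == v ⟧ - ⟦ w == v ⟧)             ∎
        where
        open ≡-Reasoning
        lemma : ∀ a s u w → 1ℤ * (a + (s - u)) + (u - w) ≡ a + (s - w)
        lemma = solve-∀
      y′-out : ∀ e → Inside (insert S w) e ≡ false → y′ e ≡ x e
      y′-out e out with e₀ ≟ e
      ... | yes refl = contradiction (trans (sym in₀) out) λ ()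
      ... | no _     = trans (sym (y′-other e)) (y-out e (outside-insert S w e out))

    insert-shrinks : ∀ S w k → S w ≡ false → ∑ (λ v → ⟦ not (S v) ⟧) ≤ + suc k →
      ∑ (λ v → ⟦ not (insert S w v) ⟧) ≤ + k
    insert-shrinks S w k Sw small = ungap (by (lemma (∑ (λ v → ⟦ not (S v) ⟧)) (∑ (λ v → ⟦ not (insert S w v) ⟧)) _ refl)
      (gap small ⊞ total-nonneg c pointwise))
      where
      c : Combination n
      c = (1ℤ , λ v → ⟦ not (S v) ⟧) ∷ (-1ℤ , λ v → ⟦ not (insert S w v) ⟧) ∷ (-1ℤ , λ v → ⟦ w == v ⟧) ∷ []
      pointwise : ∀ v → 0ℤ ≤ at c v
      pointwise v with w ≟ v
      ... | yes refl rewrite Sw = +≤+ z≤n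
      ... | no _ with S v
      ... | true  = +≤+ z≤n
      ... | false = +≤+ z≤n
      lemma : ∀ a b d → d ≡ ∑ (λ v → ⟦ w == v ⟧) →
        + suc k - a + (1ℤ * a + (-1ℤ * b + (-1ℤ * d + 0ℤ))) ≡ + k - b
      lemma a b d eq rewrite trans eq (∑-δ w) = rearr a b (+ k)
        where
        rearr : ∀ a b k → 1ℤ + k - a + (1ℤ * a + (-1ℤ * b + (-1ℤ * 1ℤ + 0ℤ))) ≡ k - b
        rearr = solve-∀

    complement-empty : ∀ (S : Fin n → Bool) w → S w ≡ false → ¬ (∑ (λ v → ⟦ not (S v) ⟧) ≤ 0ℤ)
    complement-empty S w Sw small =
      contradiction (trans (sym (term-zero {f = λ v → ⟦ not (S v) ⟧} (λ v → ⟦⟧-nonneg (not (S v))) small w))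
        (cong (λ c → ⟦ not c ⟧) Sw)) λ ()

    -- `k` bounds the number of vertices outside `S`; each residual edge that leaves `S` brings its
    -- outer end in. At 0 there is no vertex for such an edge to lead to.
    closure : ∀ k S → S s ≡ true → (∀ w → S w ≡ true → Reach S w) → ∑ (λ v → ⟦ not (S v) ⟧) ≤ + k →
      ∃[ S ] S s ≡ true × (∀ w → S w ≡ true → Reach S w) × Closed S
    closure k S Ss reach small
      with any? (λ e → (S (t e) Bool.≟ true) ×-dec (S (h e) Bool.≟ false) ×-dec (x e ℤ.<? hi e))
         | any? (λ e → (S (t e) Bool.≟ false) ×-dec (S (h e) Bool.≟ true) ×-dec (lo e ℤ.<? x e))
    ... | no ¬fwd | no ¬bwd = S , Ss , reach , (λ e p → ¬fwd (e , p)) , (λ e p → ¬bwd (e , p))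
    closure zero S _ _ small | yes (e , _ , Sh , _) | _ = contradiction small (complement-empty S (h e) Sh)
    closure zero S _ _ small | no _ | yes (e , St , _ , _) = contradiction small (complement-empty S (t e) St)
    closure (suc k) S Ss reach small | yes (e , St , Sh , x<hi) | _ =
      closure k (insert S (h e)) (insert-old S (h e) Ss)
        (extend S {w = h e} e 1ℤ St (trans (cong₂ _∧_ St Sh) refl)
          (cong₂ _∧_ (insert-old S (h e) St) (insert-new S (h e)))
          (ungap (by (lo-lemma (x e) (lo e)) (gap (proj₁ (x-bounded e)) ⊞ +≤+ z≤n)))
          (ungap (by (hi-lemma (x e) (hi e)) (strict-gap x<hi)))
          (λ v → ℤ.*-identityˡ _) reach)
        (insert-shrinks S (h e) k Sh small)
      where
      lo-lemma : ∀ x l → x - l + 1ℤ ≡ x + 1ℤ - l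
      lo-lemma = solve-∀
      hi-lemma : ∀ x u → u - x - 1ℤ ≡ u - (x + 1ℤ)
      hi-lemma = solve-∀
    closure (suc k) S Ss reach small | no _ | yes (e , St , Sh , lo<x) =
      closure k (insert S (t e)) (insert-old S (t e) Ss)
        (extend S {w = t e} e -1ℤ Sh (trans (cong₂ _∧_ St Sh) refl)
          (cong₂ _∧_ (insert-new S (t e)) (insert-old S (t e) Sh))
          (ungap (by (lo-lemma (x e) (lo e)) (strict-gap lo<x)))
          (ungap (by (hi-lemma (x e) (hi e)) (gap (proj₂ (x-bounded e)) ⊞ +≤+ z≤n)))
          (λ v → swap ⟦ t e == v ⟧ ⟦ h e == v ⟧) reach)
        (insert-shrinks S (t e) k St small)
      where
      lo-lemma : ∀ x l → x - l - 1ℤ ≡ x + -1ℤ - l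
      lo-lemma = solve-∀
      hi-lemma : ∀ x u → u - x + 1ℤ ≡ u - (x + -1ℤ)
      hi-lemma = solve-∀
      swap : ∀ a b → -1ℤ * (a - b) ≡ b - a
      swap = solve-∀

  excess : (Fin m → ℤ) → Fin n → ℤ
  excess x v = b v - net x v

  -- Without residual edges leaving `S`, the edges out of `S` are at `hi` and the edges into `S` at
  -- `lo`, so the flow out of `S` attains the capacity.
  closed-saturated : ∀ x (x-bounded : Bounded x) s S → Closed x x-bounded s S →
    ∀ e → x e * (⟦ S (t e) ⟧ - ⟦ S (h e) ⟧) ≡ capacity S e
  closed-saturated x x-bounded s S (out , in′) e with S (t e) in St | S (h e) in Sh
  ... | true  | true  = ℤ.*-zeroʳ (x e)
  ... | false | false = ℤ.*-zeroʳ (x e)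
  ... | true  | false = trans (ℤ.*-identityʳ (x e))
    (≤-antisym (proj₂ (x-bounded e)) (ℤ.≮⇒≥ (λ x<hi → out e (St , Sh , x<hi))))
  ... | false | true  = trans (trans (ℤ.*-comm (x e) -1ℤ) (ℤ.-1*i≡-i (x e)))
    (cong -_ (≤-antisym (ℤ.≮⇒≥ (λ lo<x → in′ e (St , Sh , lo<x))) (proj₁ (x-bounded e))))

  sum-split : ∀ x (S : Fin n → Bool) → ∑ (λ v → ⟦ S v ⟧ * b v) ≡
    ∑ (λ v → ⟦ S v ⟧ * excess x v) + ∑ (λ e → x e * (⟦ S (t e) ⟧ - ⟦ S (h e) ⟧))
  sum-split x S = begin
    ∑ (λ v → ⟦ S v ⟧ * b v)
      ≡⟨ ∑-cong (λ v → lemma ⟦ S v ⟧ (b v) (net x v)) ⟩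
    ∑ (λ v → ⟦ S v ⟧ * excess x v + ⟦ S v ⟧ * net x v)
      ≡⟨ ∑-+ (λ v → ⟦ S v ⟧ * excess x v) (λ v → ⟦ S v ⟧ * net x v) ⟩
    ∑ (λ v → ⟦ S v ⟧ * excess x v) + ∑ (λ v → ⟦ S v ⟧ * net x v)
      ≡⟨ cong (_+_ (∑ (λ v → ⟦ S v ⟧ * excess x v))) (net-pairing x (λ v → ⟦ S v ⟧)) ⟩
    ∑ (λ v → ⟦ S v ⟧ * excess x v) + ∑ (λ e → x e * (⟦ S (t e) ⟧ - ⟦ S (h e) ⟧)) ∎
    where
    open ≡-Reasoning
    lemma : ∀ c b x → c * b ≡ c * (b - x) + c * x
    lemma = solve-∀

  positive-part : ℤ → ℤ
  positive-part (+ k)    = + k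
  positive-part -[1+ k ] = 0ℤ

  positive-part-nonneg : ∀ i → 0ℤ ≤ positive-part i
  positive-part-nonneg (+ k)    = +≤+ z≤n
  positive-part-nonneg -[1+ k ] = ≤-refl

  i≤positive-part : ∀ i → i ≤ positive-part i
  i≤positive-part (+ k)    = ≤-refl
  i≤positive-part -[1+ k ] = -≤+

  positive-part-suc : ∀ i → i < 0ℤ → positive-part (i + 1ℤ) ≤ positive-part i
  positive-part-suc -[1+ zero ]  _ = ≤-refl
  positive-part-suc -[1+ suc k ] _ = ≤-refl
  positive-part-suc (+ k) (+<+ ())

  positive-part-pred : ∀ i → 0ℤ < i → positive-part (i - 1ℤ) ≤ positive-part i - 1ℤ
  positive-part-pred (+ suc k) _ = ≤-refl
  positive-part-pred (+ zero) (+<+ ())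

  -- One unit sent from `s` to `w` lowers the positive excess of `s` by 1, while the negative excess
  -- of `w` rises to at most 0 and still contributes nothing. The sum of the positive parts
  -- therefore measures progress.
  potential-drops : ∀ x y s w k → 0ℤ < excess x s → excess x w < 0ℤ →
    (∀ v → net y v ≡ net x v + (⟦ s == v ⟧ - ⟦ w == v ⟧)) →
    ∑ (λ v → positive-part (excess x v)) ≤ + suc k → ∑ (λ v → positive-part (excess y v)) ≤ + k
  potential-drops x y s w k s-pos w-neg y-net small =
    ungap (by (lemma (∑ (λ v → positive-part (excess x v))) (∑ (λ v → positive-part (excess y v))) _ refl)
      (gap small ⊞ total-nonneg c pointwise))
    where
    c : Combination n
    c = (1ℤ , λ v → positive-part (excess x v)) ∷ (-1ℤ , λ v → positive-part (excess y v)) ∷ (-1ℤ , λ v → ⟦ s == v ⟧) ∷ []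
    rearr : ∀ b x d → b - (x + d) ≡ b - x - d
    rearr = solve-∀
    expand : ∀ a b d → a - d - b ≡ 1ℤ * a + (-1ℤ * b + (-1ℤ * d + 0ℤ))
    expand = solve-∀
    drop : ∀ v → positive-part (excess x v - (⟦ s == v ⟧ - ⟦ w == v ⟧)) ≤ positive-part (excess x v) - ⟦ s == v ⟧
    drop v with s ≟ v | w ≟ v
    ... | yes refl | yes refl = contradiction (ℤ.<-trans s-pos w-neg) (ℤ.<-irrefl refl)
    ... | yes refl | no _     = positive-part-pred (excess x v) s-pos
    ... | no _     | no _     rewrite ℤ.+-identityʳ (excess x v) = ≤-reflexive (sym (ℤ.+-identityʳ _))
    ... | no _     | yes refl = ≤-trans (positive-part-suc (excess x v) w-neg) (≤-reflexive (sym (ℤ.+-identityʳ _)))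
    pointwise : ∀ v → 0ℤ ≤ at c v
    pointwise v rewrite y-net v | rearr (b v) (net x v) (⟦ s == v ⟧ - ⟦ w == v ⟧) =
      by (expand (positive-part (excess x v)) (positive-part (excess x v - (⟦ s == v ⟧ - ⟦ w == v ⟧))) ⟦ s == v ⟧) (gap (drop v))
    lemma : ∀ a b d → d ≡ ∑ (λ v → ⟦ s == v ⟧) →
      + suc k - a + (1ℤ * a + (-1ℤ * b + (-1ℤ * d + 0ℤ))) ≡ + k - b
    lemma a b d eq rewrite trans eq (∑-δ s) = rearr′ a b (+ k)
      where
      rearr′ : ∀ a b k → 1ℤ + k - a + (1ℤ * a + (-1ℤ * b + (-1ℤ * 1ℤ + 0ℤ))) ≡ k - b
      rearr′ = solve-∀

  module _ (∑b≡0 : ∑ b ≡ 0ℤ) where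

    sum-excess : ∀ x → ∑ (excess x) ≡ 0ℤ
    sum-excess x = trans (∑-minus b (net x)) (cong₂ _-_ ∑b≡0 (sum-net x))

    -- The excesses sum to 0, so if none is positive, none is negative either.
    no-excess : ∀ x → (∀ v → ¬ (0ℤ < excess x v)) → ∀ v → net x v ≡ b v
    no-excess x none v = sym (ℤ.i-j≡0⇒i≡j (b v) (net x v) (≤-antisym (ℤ.≮⇒≥ (none v)) (ℤ.neg-cancel-≤
      (≤-trans (term≤∑ {f = λ v → - excess x v} (λ v → ℤ.neg-mono-≤ (ℤ.≮⇒≥ (none v))) v) (≤-reflexive sum-neg)))))
      where
      sum-neg : ∑ (λ v → - excess x v) ≡ 0ℤ
      sum-neg = trans (∑-cong (λ v → sym (ℤ.-1*i≡-i (excess x v))))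
        (trans (∑-* -1ℤ (excess x)) (cong (_*_ -1ℤ) (sum-excess x)))

    improve : ∀ k x → Bounded x → ∑ (λ v → positive-part (excess x v)) ≤ + k → Feasible ⊎ Violated
    improve k x x-bounded small with any? (λ v → 0ℤ ℤ.<? excess x v)
    ... | no none = inj₁ (x , x-bounded , no-excess x (λ v p → none (v , p)))
    improve zero x x-bounded small | yes (s , s-pos) =
      contradiction (≤-trans (≤-trans (i≤positive-part (excess x s)) (term≤∑ (λ v → positive-part-nonneg (excess x v)) s)) small)
        (ℤ.<⇒≱ s-pos)
    improve (suc k) x x-bounded small | yes (s , s-pos)
      with closure x x-bounded s _ (_==_ s) (==-refl s) start (≤-reflexive (sym (ℤ.0≤i⇒+∣i∣≡i (∑-nonneg (λ v → ⟦⟧-nonneg (not (s == v)))))))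
      where
      start : ∀ w → s == w ≡ true → Reach x x-bounded s (_==_ s) w
      start w eq with ==⇒≡ {u = s} eq
      ... | refl = x , x-bounded , (λ v → sym (trans (cong (_+_ (net x v)) (ℤ.+-inverseʳ ⟦ s == v ⟧)) (ℤ.+-identityʳ _))) , λ _ _ → refl
    ... | S , Ss , reach , closed with any? (λ w → (S w Bool.≟ true) ×-dec (excess x w ℤ.<? 0ℤ))
    ... | yes (w , Sw , w-neg) =
      let y , y-bounded , y-net , _ = reach w Sw
      in improve k y y-bounded (potential-drops x y s w k s-pos w-neg y-net small)
    -- All excesses in `S` are nonnegative and that of `s` is positive, while the flow out of `S`
    -- already equals the capacity. So `b` demands more of `S` than the bounds permit.
    ... | no none = inj₂ (S , violates)
      where
      excess-nonneg : ∀ v → 0ℤ ≤ ⟦ S v ⟧ * excess x v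
      excess-nonneg v with S v in Sv
      ... | false = ≤-refl
      ... | true  = subst (0ℤ ≤_) (sym (ℤ.*-identityˡ _)) (ℤ.≮⇒≥ (λ neg → none (v , Sv , neg)))
      at-s : ⟦ S s ⟧ * excess x s ≡ excess x s
      at-s rewrite Ss = ℤ.*-identityˡ _
      violates : ∑ (capacity S) < ∑ (λ v → ⟦ S v ⟧ * b v)
      violates = subst₂ _<_
        (trans (ℤ.+-identityˡ (∑ (λ e → x e * (⟦ S (t e) ⟧ - ⟦ S (h e) ⟧)))) (∑-cong (closed-saturated x x-bounded s S closed)))
        (sym (sum-split x S))
        (ℤ.+-monoˡ-< (∑ (λ e → x e * (⟦ S (t e) ⟧ - ⟦ S (h e) ⟧))) (ℤ.<-≤-trans (subst (0ℤ <_) (sym at-s) s-pos) (term≤∑ excess-nonneg s)))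

    hoffman : (∀ e → lo e ≤ hi e) → Feasible ⊎ Violated
    hoffman lo≤hi = improve _ lo (λ e → ≤-refl , lo≤hi e)
      (≤-reflexive (sym (ℤ.0≤i⇒+∣i∣≡i (∑-nonneg (λ v → positive-part-nonneg (excess lo v))))))

-- Degrees, and flows with values ±1 on even subgraphs

sgn : Bool → ℤ
sgn b = if b then 1ℤ else -1ℤ

∀-Bool? : ∀ {p} {P : Bool → Set p} → (∀ b → Dec (P b)) → Dec (∀ b → P b)
∀-Bool? P? with P? false | P? true
... | yes p | yes q = yes λ { false → p ; true → q }
... | no ¬p | _     = no λ f → ¬p (f false)
... | yes _ | no ¬q = no λ f → ¬q (f true)

∑-fromℕ : ∀ {n} (f : Fin n → ℕ) → ∑ (λ i → + f i) ≡ + ℕ-Sum.sum f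
∑-fromℕ {zero}  f = ∑-zero (λ i → + f i)
∑-fromℕ {suc n} f = trans (∑-suc (λ i → + f i)) (cong (_+_ (+ f zero)) (∑-fromℕ (λ i → f (suc i))))

module Degrees {m n : ℕ} (t h : Fin m → Fin n) where
  open Circulation t h

  deg : (Fin m → ℤ) → Fin n → ℤ
  deg c v = push t c v + push h c v

  deg-cong : ∀ {x y} → (∀ e → x e ≡ y e) → ∀ v → deg x v ≡ deg y v
  deg-cong x≗y v = cong₂ _+_ (push-cong t x≗y v) (push-cong h x≗y v)

  net-cong : ∀ {x y} → (∀ e → x e ≡ y e) → ∀ v → net x v ≡ net y v
  net-cong x≗y v = cong₂ _-_ (push-cong t x≗y v) (push-cong h x≗y v)

  deg-lin : ∀ a x b y v → deg (λ e → a * x e + b * y e) v ≡ a * deg x v + b * deg y v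
  deg-lin a x b y v = trans (cong₂ _+_ (push-lin t a x b y v) (push-lin h a x b y v)) (rearr a b _ _ _ _)
    where
    rearr : ∀ a b p q r s → a * p + b * q + (a * r + b * s) ≡ a * (p + r) + b * (q + s)
    rearr = solve-∀

  deg-pairing : ∀ c (g : Fin n → ℤ) →
    ∑ (λ v → g v * deg c v) ≡ ∑ (λ e → c e * (g (t e) + g (h e)))
  deg-pairing c g = begin
    ∑ (λ v → g v * deg c v)                               ≡⟨ ∑-cong (λ v → ℤ.*-distribˡ-+ (g v) (push t c v) (push h c v)) ⟩
    ∑ (λ v → g v * push t c v + g v * push h c v)         ≡⟨ ∑-+ _ _ ⟩
    ∑ (λ v → g v * push t c v) + ∑ (λ v → g v * push h c v) ≡⟨ cong₂ _+_ (push-pairing t c g) (push-pairing h c g) ⟩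
    ∑ (λ e → c e * g (t e)) + ∑ (λ e → c e * g (h e))     ≡⟨ ∑-+ _ _ ⟨
    ∑ (λ e → c e * g (t e) + c e * g (h e))               ≡⟨ ∑-cong (λ e → ℤ.*-distribˡ-+ (c e) (g (t e)) (g (h e))) ⟨
    ∑ (λ e → c e * (g (t e) + g (h e)))                   ∎
    where open ≡-Reasoning

  deg-as-∑ : ∀ c v → deg c v ≡ ∑ (λ e → c e * (⟦ t e == v ⟧ + ⟦ h e == v ⟧))
  deg-as-∑ c v = trans (sym (∑-+ _ _))
    (∑-cong (λ e → sym (ℤ.*-distribˡ-+ (c e) ⟦ t e == v ⟧ ⟦ h e == v ⟧)))

  module _ (S : Fin m → Bool) (k : Fin n → ℤ) (even : ∀ v → deg (λ e → ⟦ S e ⟧) v ≡ + 2 * k v) where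
    private
      s : Fin m → ℤ
      s e = ⟦ S e ⟧

      -- Half of the net outflow of the indicator of `S`, which is an integer because the degrees in
      -- `S` are even.
      b : Fin n → ℤ
      b v = k v - push h s v

      2b : ∀ v → + 2 * b v ≡ net s v
      2b v = trans (dist (k v) (push h s v))
        (trans (cong (_- (+ 2 * push h s v)) (sym (even v))) (cancel (push t s v) (push h s v)))
        where
        dist : ∀ a b → + 2 * (a - b) ≡ + 2 * a - + 2 * b
        dist = solve-∀
        cancel : ∀ a b → a + b - + 2 * b ≡ a - b
        cancel = solve-∀

      ∑b≡0 : ∑ b ≡ 0ℤ
      ∑b≡0 = ℤ.*-cancelˡ-≡ (+ 2) _ 0ℤ (trans (sym (∑-* (+ 2) b)) (trans (∑-cong 2b) (sum-net s)))

      open Hoffman t h (λ _ → 0ℤ) s b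

      -- Twice the demand of `X` is the number of edges of `S` leaving `X` minus the number entering
      -- it. The capacity is the first of these numbers, so even half of it suffices.
      not-violated : ¬ Violated
      not-violated (X , violated) = 0≰-1 (by (collect (∑ (capacity X)) (∑ (λ v → ⟦ X v ⟧ * b v)))
        -- The violation is used twice because only the double of the demand is known; this would
        -- give -2, and the filler 0 ≤ 1 adjusts it to -1.
        (strict-gap violated ⊞ strict-gap violated ⊞ +≤+ (z≤n {1}) ⊞ by (cong (λ z → + 2 * ∑ (capacity X) + (-1ℤ * z + 0ℤ)) double) (total-nonneg c pointwise)))
        where
        c : Combination m
        c = (+ 2 , capacity X) ∷ (-1ℤ , λ e → s e * (⟦ X (t e) ⟧ - ⟦ X (h e) ⟧)) ∷ []
        pointwise : ∀ e → 0ℤ ≤ at c e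
        pointwise e with X (t e) | X (h e) | S e
        ... | true  | true  | true  = +≤+ z≤n
        ... | true  | true  | false = +≤+ z≤n
        ... | true  | false | true  = +≤+ z≤n
        ... | true  | false | false = +≤+ z≤n
        ... | false | true  | true  = +≤+ z≤n
        ... | false | true  | false = +≤+ z≤n
        ... | false | false | true  = +≤+ z≤n
        ... | false | false | false = +≤+ z≤n
        swap : ∀ a b → a * (+ 2 * b) ≡ + 2 * (a * b)
        swap = solve-∀
        double : ∑ (λ e → s e * (⟦ X (t e) ⟧ - ⟦ X (h e) ⟧)) ≡ + 2 * ∑ (λ v → ⟦ X v ⟧ * b v)
        double = trans (sym (net-pairing s (λ v → ⟦ X v ⟧)))
          (trans (∑-cong (λ v → trans (cong (_*_ ⟦ X v ⟧) (sym (2b v))) (swap ⟦ X v ⟧ (b v))))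
            (∑-* (+ 2) (λ v → ⟦ X v ⟧ * b v)))
        collect : ∀ c β → (β - c - 1ℤ) + (β - c - 1ℤ) + 1ℤ + (+ 2 * c + (-1ℤ * (+ 2 * β) + 0ℤ)) ≡ -1ℤ
        collect = solve-∀

      orient : ∀ σ x → 0ℤ ≤ x → x ≤ ⟦ σ ⟧ → ⟦ σ ⟧ * sgn (does (0ℤ ℤ.<? x)) ≡ + 2 * x + -1ℤ * ⟦ σ ⟧
      orient false (+ zero)        _ _                = refl
      orient true  (+ zero)        _ _                = refl
      orient true  (+ suc zero)    _ _                = refl
      orient false (+ suc _)       _ (+≤+ ())
      orient true  (+ suc (suc _)) _ (+≤+ (s≤s ()))

    -- 2x - 1 takes the values ±1 on S iff x takes the values 0 and 1, which
    -- turns the flow sought for into one with prescribed excesses.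
    even-flow : ∃[ y ] ∀ v → net (λ e → ⟦ S e ⟧ * sgn (y e)) v ≡ 0ℤ
    even-flow with hoffman ∑b≡0 (λ e → ⟦⟧-nonneg (S e))
    ... | inj₂ violated = contradiction violated not-violated
    ... | inj₁ (x , x-bounded , x-net) = (λ e → does (0ℤ ℤ.<? x e)) , λ v →
      trans (net-cong (λ e → orient (S e) (x e) (proj₁ (x-bounded e)) (proj₂ (x-bounded e))) v)
      (trans (net-lin (+ 2) x -1ℤ s v)
      (trans (cong₂ _+_ (trans (cong (_*_ (+ 2)) (x-net v)) (2b v)) (ℤ.-1*i≡-i (net s v))) (ℤ.+-inverseʳ (net s v))))

-- From circulations to nowhere-zero 5-flows

lower upper : Bool → ℤ
lower d = if d then 1ℤ else -[1+ 3 ]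
upper d = if d then + 4 else -1ℤ

module _ (G : Graph) where
  open Graph G

  source target : Edge → Vertex
  source e = proj₁ (ends e)
  target e = proj₂ (ends e)

  open Circulation source target
  open Degrees source target

  degree-deg : ∀ F v → + degree G F v ≡ deg (λ e → ⟦ lookup F e ⟧) v
  degree-deg F v = trans (sym (∑-fromℕ _)) (trans (∑-cong pointwise) (sym (deg-as-∑ (λ e → ⟦ lookup F e ⟧) v)))
    where
    pointwise : ∀ e → + (if lookup F e then δ (source e) v ℕ.+ δ (target e) v else 0)
      ≡ ⟦ lookup F e ⟧ * (⟦ source e == v ⟧ + ⟦ target e == v ⟧)
    pointwise e with lookup F e | source e == v | target e == v
    ... | true  | true  | true  = refl
    ... | true  | true  | false = refl
    ... | true  | false | true  = refl
    ... | true  | false | false = refl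
    ... | false | true  | true  = refl
    ... | false | true  | false = refl
    ... | false | false | true  = refl
    ... | false | false | false = refl


  -- `z` is signed with respect to the stored order of the ends. The bounds force its sign to agree
  -- with `d`, so turning the negative edges around leaves a flow with values from 1 to 4.
  circulation→flow : (d : Edge → Bool) (z : Edge → ℤ) →
    (∀ e → lower (d e) ≤ z e × z e ≤ upper (d e)) → (∀ v → net z v ≡ 0ℤ) → NowhereZeroFlow G 5
  circulation→flow d z bounded circ = record
    { direction = d
    ; value     = λ e → ∣ z e ∣
    ; value≥1   = λ e → value≥1 (d e) (z e) (proj₁ (bounded e)) (proj₂ (bounded e))
    ; value<k   = λ e → value<5 (d e) (z e) (proj₁ (bounded e)) (proj₂ (bounded e))
    ; kirchhoff = λ v → ℤ.+-injective (sym (ℤ.i-j≡0⇒i≡j _ _ (trans (sym (net≡out-in v)) (circ v))))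
    }
    where
    value≥1 : ∀ b i → lower b ≤ i → i ≤ upper b → 1 ℕ.≤ ∣ i ∣
    value≥1 true  (+ suc i)   _        _ = s≤s z≤n
    value≥1 false -[1+ i ]    _        _ = s≤s z≤n
    value≥1 true  (+ zero)    (+≤+ ()) _
    value≥1 false (+ i)       _        ()
    value<5 : ∀ b i → lower b ≤ i → i ≤ upper b → ∣ i ∣ ℕ.< 5
    value<5 true  (+ i)       _        (+≤+ i≤4) = s≤s i≤4
    value<5 false -[1+ i ]    (-≤- i≤3) _        = s≤s (s≤s i≤3)
    value<5 false (+ i)       _        ()
    signed : ∀ b i p q → lower b ≤ i → i ≤ upper b →
      i * (⟦ p ⟧ - ⟦ q ⟧) ≡
      + (if (if b then p else q) then ∣ i ∣ else 0) - + (if (if b then q else p) then ∣ i ∣ else 0)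
    signed b     i true  true  _ _ with b
    ... | true  = trans (ℤ.*-zeroʳ i) (sym (ℤ.+-inverseʳ (+ ∣ i ∣)))
    ... | false = trans (ℤ.*-zeroʳ i) (sym (ℤ.+-inverseʳ (+ ∣ i ∣)))
    signed b     i false false _ _ with b
    ... | true  = ℤ.*-zeroʳ i
    ... | false = ℤ.*-zeroʳ i
    signed true  (+ i) true false _ _ = trans (ℤ.*-identityʳ (+ i)) (sym (ℤ.+-identityʳ (+ i)))
    signed true  (+ i) false true _ _ = trans (ℤ.*-comm (+ i) -1ℤ) (trans (ℤ.-1*i≡-i (+ i)) (sym (ℤ.+-identityˡ _)))
    signed false -[1+ i ] true false _ _ = ℤ.*-identityʳ -[1+ i ]
    signed false -[1+ i ] false true _ _ = trans (ℤ.*-comm -[1+ i ] -1ℤ) (trans (ℤ.-1*i≡-i -[1+ i ]) (sym (ℤ.+-identityʳ _)))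
    signed false (+ i) _ _ _ ()
    select : (b : Bool) (u w v : Vertex) → (if b then u else w) == v ≡ (if b then u == v else (w == v))
    select true  _ _ _ = refl
    select false _ _ _ = refl
    pointwise : ∀ v e → z e * ⟦ source e == v ⟧ - z e * ⟦ target e == v ⟧ ≡
      + (if tail G d e == v then ∣ z e ∣ else 0) - + (if head G d e == v then ∣ z e ∣ else 0)
    pointwise v e rewrite select (d e) (source e) (target e) v | select (d e) (target e) (source e) v =
      trans (dist (z e) ⟦ source e == v ⟧ ⟦ target e == v ⟧)
        (signed (d e) (z e) (source e == v) (target e == v) (proj₁ (bounded e)) (proj₂ (bounded e)))
      where
      dist : ∀ a b c → a * b - a * c ≡ a * (b - c)
      dist = solve-∀
    net≡out-in : ∀ v → net z v ≡ + outflow G d (λ e → ∣ z e ∣) v - + inflow G d (λ e → ∣ z e ∣) v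
    net≡out-in v = trans (sym (∑-minus (λ e → z e * ⟦ source e == v ⟧) (λ e → z e * ⟦ target e == v ⟧)))
      (trans (∑-cong (pointwise v)) (trans (∑-minus (λ e → + (if tail G d e == v then ∣ z e ∣ else 0)) (λ e → + (if head G d e == v then ∣ z e ∣ else 0))) (cong₂ _-_ (∑-fromℕ _) (∑-fromℕ _))))

-- Circuits and induced forests

lookup-injective : ∀ {a} {A : Set a} {xs : List A} → Unique xs →
  ∀ {i j} → List.lookup xs i ≡ List.lookup xs j → i ≡ j
lookup-injective (x∉ ∷ u) {zero}  {zero}  eq = refl
lookup-injective (x∉ ∷ u) {zero}  {suc j} eq = contradiction eq (All.lookup x∉ (∈-lookup j))
lookup-injective (x∉ ∷ u) {suc i} {zero}  eq = contradiction (sym eq) (All.lookup x∉ (∈-lookup i))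
lookup-injective (x∉ ∷ u) {suc i} {suc j} eq = cong suc (lookup-injective u eq)

unique-length : ∀ {n} {xs : List (Fin n)} → Unique xs → length xs ℕ.≤ n
unique-length u = Fin.injective⇒≤ (lookup-injective u)

fresh : ∀ {a} {A : Set a} {x : A} {xs} → x ∉ xs → All (x ≢_) xs
fresh x∉xs = All.tabulate λ { y∈xs refl → x∉xs y∈xs }

∉-head : ∀ {a} {A : Set a} {x : A} {xs} → All (x ≢_) xs → x ∉ xs
∉-head x∉ x∈ = All.lookup x∉ x∈ refl

module Circuits (G : Graph) where
  open Graph G
  t h : Edge → Vertex
  t = source G
  h = target G
  open Circulation t h
  open Degrees t h

  inner : (Vertex → Bool) → Edge → Bool
  inner A e = A (t e) ∧ A (h e)

  -- Quantified over `F` because the type of circuits depends on the ambient edge set. Eventually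
  -- `F` is the complement of a cut, one and the same for both of its sides.
  HasCircuit : (Vertex → Bool) → Set
  HasCircuit A = ∀ F → (∀ e → inner A e ≡ true → e ∈ₛ F) →
    ∃ λ (c : Circuit G F) → All (λ v → A v ≡ true) (walkVertices G (Circuit.walk c))

  inner-degree : (Vertex → Bool) → Vertex → ℤ
  inner-degree A = deg (λ e → ⟦ inner A e ⟧)

  incident : Edge → Vertex → Bool
  incident e v = t e == v ∨ h e == v

  module Search (A : Vertex → Bool) (F : Subset size) (inner⊆F : ∀ e → inner A e ≡ true → e ∈ₛ F)
    (rich : ∀ v → A v ≡ true → + 2 ≤ inner-degree A v) where

    -- If every inner edge at `v` had to be avoided, these edges would have degree at least 2 and at
    -- most 1 at `v`.
    find-edge : ∀ v (avoid : Edge → Bool) → A v ≡ true →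
      deg (λ e → ⟦ inner A e ∧ avoid e ⟧) v ≤ 1ℤ →
      ∃[ e ] inner A e ≡ true × incident e v ≡ true × avoid e ≡ false
    find-edge v avoid Av few
      with any? (λ e → (inner A e Bool.≟ true) ×-dec (incident e v Bool.≟ true) ×-dec (avoid e Bool.≟ false))
    ... | yes found = found
    ... | no none = contradiction (≤-trans (rich v Av) (≤-trans more few)) λ { (+≤+ (s≤s ())) }
      where
      pointwise : ∀ e → ⟦ inner A e ⟧ * (⟦ t e == v ⟧ + ⟦ h e == v ⟧) ≤ ⟦ inner A e ∧ avoid e ⟧ * (⟦ t e == v ⟧ + ⟦ h e == v ⟧)
      pointwise e with inner A e in i | avoid e in a | t e == v in p | h e == v in q
      ... | false | _     | _     | _     = ≤-refl
      ... | true  | true  | _     | _     = ≤-refl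
      ... | true  | false | false | false = ≤-refl
      ... | true  | false | true  | _     = contradiction (e , i , cong₂ _∨_ p refl , a) none
      ... | true  | false | false | true  = contradiction (e , i , cong₂ _∨_ p q , a) none
      more : inner-degree A v ≤ deg (λ e → ⟦ inner A e ∧ avoid e ⟧) v
      more = subst₂ _≤_ (sym (deg-as-∑ (λ e → ⟦ inner A e ⟧) v)) (sym (deg-as-∑ (λ e → ⟦ inner A e ∧ avoid e ⟧) v)) (∑-mono pointwise)

    visited : ∀ {u b} → Walk G F u b → List Vertex
    visited {u} stop           = u ∷ []
    visited {u} (step _ _ _ p) = u ∷ visited p

    start∈visited : ∀ {u b} (p : Walk G F u b) → u ∈ visited p
    start∈visited stop           = here refl
    start∈visited (step _ _ _ p) = here refl

    joins-incident : ∀ {e u w v} → Joins G e u w → incident e v ≡ true → v ≡ u ⊎ v ≡ w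
    joins-incident {e} {v = v} j inc with t e ≟ v | j
    ... | yes refl | inj₁ refl = inj₁ refl
    ... | yes refl | inj₂ refl = inj₂ refl
    ... | no _     | inj₁ refl = inj₂ (sym (==⇒≡ inc))
    ... | no _     | inj₂ refl = inj₁ (sym (==⇒≡ inc))

    edge-ends-visited : ∀ {u b} (p : Walk G F u b) {e v} → e ∈ walkEdges G p → incident e v ≡ true → v ∈ visited p
    edge-ends-visited (step e _ j p) (here refl) inc with joins-incident j inc
    ... | inj₁ refl = here refl
    ... | inj₂ refl = there (start∈visited p)
    edge-ends-visited (step e _ j p) (there e∈p) inc = there (edge-ends-visited p e∈p inc)

    -- The part of a path up to a revisited vertex `w`; an edge from `w` back to its start closes it
    -- to a circuit.
    prefix : ∀ {u b w} (p : Walk G F u b) → w ∈ visited p → Unique (visited p) → Unique (walkEdges G p) →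
      ∃ λ (q : Walk G F u w) → Unique (w ∷ walkVertices G q) × Unique (walkEdges G q)
        × (∀ {e} → e ∈ walkEdges G q → e ∈ walkEdges G p)
        × (∀ {v} → v ∈ walkVertices G q → v ∈ visited p)
    prefix stop           (here refl) _ _ = stop , ([] ∷ []) , [] , (λ ()) , λ ()
    prefix (step _ _ _ _) (here refl) _ _ = stop , ([] ∷ []) , [] , (λ ()) , λ ()
    prefix (step e e∈F j p) (there w∈p) (u∉p ∷ p-unique) (e∉p ∷ p-edges)
      with prefix p w∈p p-unique p-edges
    ... | q , w∉q ∷ q-unique , q-edges , edges⊆ , vertices⊆ =
      step e e∈F j q
      , ((λ { refl → ∉-head u∉p w∈p }) ∷ w∉q) ∷ fresh (λ u∈q → ∉-head u∉p (vertices⊆ u∈q)) ∷ q-unique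
      , fresh (λ e∈q → ∉-head e∉p (edges⊆ e∈q)) ∷ q-edges
      , (λ { (here eq) → here eq ; (there e∈q) → there (edges⊆ e∈q) })
      , (λ { (here eq) → here eq ; (there v∈q) → there (vertices⊆ v∈q) })

    other-end : ∀ e v → inner A e ≡ true → incident e v ≡ true → ∃[ w ] Joins G e w v × A w ≡ true
    other-end e v i inc with A (t e) in At | A (h e) in Ah
    ... | true | true with t e ≟ v
    ... | yes refl = h e , inj₂ refl , Ah
    ... | no _     = t e , inj₁ (cong (t e ,_) (==⇒≡ inc)) , At

    loop-end : ∀ {e w v} → Joins G e w v → t e ≡ w → h e ≡ w → v ≡ w
    loop-end (inj₁ refl) _   h≡w = h≡w
    loop-end (inj₂ refl) t≡w _   = t≡w

    -- A path in `A` grows at its start `u` until the new edge meets a visited vertex. `avoid`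
    -- covers the path edges at `u`; as its degree there is at most 1, another inner edge remains.
    -- The visited vertices are distinct, so their number cannot exceed `order` and the fuel `k`
    -- suffices.
    search : ∀ k {u b} (p : Walk G F u b) (avoid : Edge → Bool) →
      order ℕ.< length (visited p) ℕ.+ k →
      (∀ {v} → v ∈ visited p → A v ≡ true) → Unique (visited p) → Unique (walkEdges G p) →
      deg (λ e → ⟦ inner A e ∧ avoid e ⟧) u ≤ 1ℤ →
      (∀ {e} → e ∈ walkEdges G p → incident e u ≡ true → avoid e ≡ true) →
      ∃ λ (c : Circuit G F) → All (λ v → A v ≡ true) (walkVertices G (Circuit.walk c))
    search zero p _ fuel _ p-unique _ _ _ =
      contradiction (unique-length p-unique) (ℕ.<⇒≱ (subst (order ℕ.<_) (ℕ.+-identityʳ _) fuel))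
    search (suc k) {u} p avoid fuel p⊆A p-unique p-edges few avoids
      with find-edge u avoid (p⊆A (start∈visited p)) few
    ... | e , e-inner , e-inc , e-ok with other-end e u e-inner e-inc
    ... | w , j , Aw with Any.any? (w ≟_) (visited p)
    ... | yes w∈p with prefix p w∈p p-unique p-edges
    ... | q , q-unique , q-edges , edges⊆ , vertices⊆ = record
      { base = w
      ; walk = step e (inner⊆F e e-inner) j q
      ; nonempty = λ ()
      ; distinctEdges = fresh (λ e∈q → contradiction (trans (sym (avoids (edges⊆ e∈q) e-inc)) e-ok) λ ()) ∷ q-edges
      ; distinctVertices = q-unique
      } , Aw ∷ All.tabulate (λ v∈q → p⊆A (vertices⊆ v∈q))
    search (suc k) {u} p avoid fuel p⊆A p-unique p-edges few avoids
        | e , e-inner , e-inc , e-ok | w , j , Aw | no w∉p =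
      search k (step e (inner⊆F e e-inner) j p) (e ==_)
        (subst (order ℕ.<_) (ℕ.+-suc _ k) fuel)
        (λ { (here refl) → Aw ; (there v∈p) → p⊆A v∈p })
        (fresh w∉p ∷ p-unique)
        (fresh (λ e∈p → contradiction (trans (sym (avoids e∈p e-inc)) e-ok) λ ()) ∷ p-edges)
        (≤-trans (≤-reflexive (deg-as-∑ (λ e′ → ⟦ inner A e′ ∧ e == e′ ⟧) w)) (≤-trans (∑-mono single) (≤-reflexive (∑-δ e))))
        (λ { (here refl) _ → ==-refl e ; (there e∈p) inc → contradiction (edge-ends-visited p e∈p inc) w∉p })
      where
      single : ∀ e′ → ⟦ inner A e′ ∧ e == e′ ⟧ * (⟦ t e′ == w ⟧ + ⟦ h e′ == w ⟧) ≤ ⟦ e == e′ ⟧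
      single e′ with e ≟ e′
      ... | no _ rewrite Bool.∧-zeroʳ (inner A e′) = ≤-refl
      ... | yes refl rewrite e-inner with t e ≟ w | h e ≟ w
      ... | no _  | no _  = +≤+ z≤n
      ... | yes _ | no _  = ≤-refl
      ... | no _  | yes _ = ≤-refl
      -- A loop at `w` would make `w` equal to `u`, which is visited. Hence the new edge has degree
      -- only 1 at `w`.
      ... | yes t≡w | yes h≡w = contradiction (subst (_∈ visited p) (loop-end j t≡w h≡w) (start∈visited p)) w∉p

  circuit-in-rich : ∀ A {u} → A u ≡ true → (∀ v → A v ≡ true → + 2 ≤ inner-degree A v) → HasCircuit A
  circuit-in-rich A {u} Au rich F inner⊆F =
    search order stop (λ _ → false) ℕ.≤-refl (λ { (here refl) → Au }) ([] ∷ []) []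
      (≤-trans (≤-reflexive (trans (deg-as-∑ (λ e → ⟦ inner A e ∧ false ⟧) u) (∑-0 vanish))) (+≤+ z≤n)) λ ()
    where
    open Search A F inner⊆F rich
    vanish : ∀ e → ⟦ inner A e ∧ false ⟧ * (⟦ t e == u ⟧ + ⟦ h e == u ⟧) ≡ 0ℤ
    vanish e rewrite Bool.∧-zeroʳ (inner A e) = refl

-- Edge cuts of cubic graphs

∑-lookup : ∀ {n} (S : Subset n) → ∑ (λ e → ⟦ lookup S e ⟧) ≡ + ∣ S ∣ₛ
∑-lookup {zero}  []          = ∑-zero _
∑-lookup {suc n} (true  ∷ S) = trans (∑-suc (λ e → ⟦ lookup (true ∷ S) e ⟧)) (cong (_+_ 1ℤ) (∑-lookup S))
∑-lookup {suc n} (false ∷ S) = trans (∑-suc (λ e → ⟦ lookup (false ∷ S) e ⟧)) (trans (ℤ.+-identityˡ _) (∑-lookup S))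

∧-trueˡ : ∀ {a b} → a ∧ b ≡ true → a ≡ true
∧-trueˡ {true} _ = refl

∧-trueʳ : ∀ {a b} → a ∧ b ≡ true → b ≡ true
∧-trueʳ {true} eq = eq

module Cuts (G : Graph) (cubic : Cubic G) where
  open Graph G
  open Circuits G
  open Circulation t h
  open Degrees t h

  card : (Vertex → Bool) → ℤ
  card A = ∑ (λ v → ⟦ A v ⟧)

  crosses : (Vertex → Bool) → Edge → Bool
  crosses A e = A (t e) xor A (h e)

  cut : (Vertex → Bool) → ℤ
  cut A = ∑ (λ e → ⟦ crosses A e ⟧)

  incidence : Vertex → Edge → ℤ
  incidence v e = ⟦ t e == v ⟧ + ⟦ h e == v ⟧

  ∑-incidence : ∀ v → ∑ (incidence v) ≡ + 3
  ∑-incidence v = begin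
    ∑ (incidence v)                                        ≡⟨ ∑-cong (λ e → sym (trans (cong (λ b → ⟦ b ⟧ * incidence v e) (lookup-replicate e true)) (ℤ.*-identityˡ _))) ⟩
    ∑ (λ e → ⟦ lookup (⊤ {n = size}) e ⟧ * incidence v e)  ≡⟨ deg-as-∑ (λ e → ⟦ lookup (⊤ {n = size}) e ⟧) v ⟨
    deg (λ e → ⟦ lookup (⊤ {n = size}) e ⟧) v              ≡⟨ degree-deg G ⊤ v ⟨
    + degree G ⊤ v                                         ≡⟨ cong +_ (cubic v) ⟩
    + 3                                                    ∎
    where open ≡-Reasoning

  remove : (Vertex → Bool) → Vertex → Vertex → Bool
  remove A v u = A u ∧ not (u == v)

  remove⊆ : ∀ A v u → remove A v u ≡ true → A u ≡ true
  remove⊆ A v u = ∧-trueˡ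

  HasCircuit-mono : ∀ {A B} → (∀ v → A v ≡ true → B v ≡ true) → HasCircuit A → HasCircuit B
  HasCircuit-mono {A} {B} A⊆B circuit F inner⊆F =
    let c , inside = circuit F (λ e i → inner⊆F e (cong₂ _∧_ (A⊆B (t e) (∧-trueˡ i)) (A⊆B (h e) (∧-trueʳ {A (t e)} i))))
    in c , All.map (λ {v} → A⊆B v) inside

  card-remove : ∀ A v → A v ≡ true → card A ≡ card (remove A v) + 1ℤ
  card-remove A v Av = begin
    card A                                            ≡⟨ ∑-cong pointwise ⟩
    ∑ (λ u → ⟦ remove A v u ⟧ + ⟦ v == u ⟧)           ≡⟨ ∑-+ _ _ ⟩
    card (remove A v) + ∑ (λ u → ⟦ v == u ⟧)          ≡⟨ cong (_+_ (card (remove A v))) (∑-δ v) ⟩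
    card (remove A v) + 1ℤ                            ∎
    where
    open ≡-Reasoning
    pointwise : ∀ u → ⟦ A u ⟧ ≡ ⟦ remove A v u ⟧ + ⟦ v == u ⟧
    pointwise u with u ≟ v | v ≟ u
    ... | yes refl | yes _  rewrite Av = refl
    ... | yes refl | no v≢v = contradiction refl v≢v
    ... | no u≢v | yes refl = contradiction refl u≢v
    ... | no _   | no _ rewrite Bool.∧-identityʳ (A u) = sym (ℤ.+-identityʳ _)

  inner-incidence : (Vertex → Bool) → Vertex → Edge → ℤ
  inner-incidence A v e = ⟦ inner A e ⟧ * incidence v e

  -- Let `d` be the inner degree of `v`. Removing `v` takes its `3 - d` crossing edges off the cut
  -- and adds its inner edges, at most `d` of them; loops count twice in `d` and are not added.
  cut-remove : ∀ A v → A v ≡ true → cut (remove A v) ≤ cut A + + 2 * inner-degree A v - + 3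
  cut-remove A v Av = ungap (by collect (total-nonneg c pointwise))
    where
    c : Combination size
    c = (-1ℤ , λ e → ⟦ crosses (remove A v) e ⟧) ∷ (1ℤ , λ e → ⟦ crosses A e ⟧)
      ∷ (+ 2 , inner-incidence A v) ∷ (-1ℤ , incidence v) ∷ []
    pointwise : ∀ e → 0ℤ ≤ at c e
    pointwise e with t e ≟ v | h e ≟ v
    ... | yes p | yes q rewrite p | q | Av = +≤+ z≤n
    ... | yes p | no _  rewrite p | Av with A (h e)
    ... | true  = +≤+ z≤n
    ... | false = +≤+ z≤n
    pointwise e | no _ | yes q rewrite q | Av with A (t e)
    ... | true  = +≤+ z≤n
    ... | false = +≤+ z≤n
    pointwise e | no _ | no _ with A (t e) | A (h e)
    ... | true  | true  = +≤+ z≤n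
    ... | true  | false = +≤+ z≤n
    ... | false | true  = +≤+ z≤n
    ... | false | false = +≤+ z≤n
    rearr : ∀ r a d → -1ℤ * r + (1ℤ * a + (+ 2 * d + (-1ℤ * + 3 + 0ℤ))) ≡ a + + 2 * d - + 3 - r
    rearr = solve-∀
    collect : total c ≡ cut A + + 2 * inner-degree A v - + 3 - cut (remove A v)
    collect = trans (cong₂ (λ d i → -1ℤ * cut (remove A v) + (1ℤ * cut A + (+ 2 * d + (-1ℤ * i + 0ℤ))))
      (sym (deg-as-∑ (λ e → ⟦ inner A e ⟧) v)) (∑-incidence v)) (rearr (cut (remove A v)) (cut A) (inner-degree A v))

  loops : Vertex → ℤ
  loops v = ∑ (λ e → ⟦ t e == v ∧ h e == v ⟧)

  module Singleton (A : Vertex → Bool) (v : Vertex) (Av : A v ≡ true) (only : ∀ u → A u ≡ true → u ≡ v) where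

    singleton-inner-degree : inner-degree A v ≡ + 2 * loops v
    singleton-inner-degree = trans (deg-as-∑ (λ e → ⟦ inner A e ⟧) v) (trans (∑-cong pointwise) (∑-* (+ 2) _))
      where
      pointwise : ∀ e → inner-incidence A v e ≡ + 2 * ⟦ t e == v ∧ h e == v ⟧
      pointwise e with t e ≟ v | h e ≟ v
      ... | yes p | yes q rewrite p | q | Av = refl
      ... | no _  | no _  = ℤ.*-zeroʳ ⟦ inner A e ⟧
      ... | yes p | no q with A (h e) in Ah
      ... | true  = contradiction (only (h e) Ah) q
      ... | false rewrite Bool.∧-zeroʳ (A (t e)) = refl
      pointwise e | no p | yes q with A (t e) in At
      ... | true  = contradiction (only (t e) At) p
      ... | false = refl

    singleton-cut : + 3 ≤ cut A + + 2 * loops v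
    singleton-cut = ungap (by collect (total-nonneg c pointwise))
      where
      c : Combination size
      c = (1ℤ , λ e → ⟦ crosses A e ⟧) ∷ (+ 2 , λ e → ⟦ t e == v ∧ h e == v ⟧) ∷ (-1ℤ , incidence v) ∷ []
      pointwise : ∀ e → 0ℤ ≤ at c e
      pointwise e with t e ≟ v | h e ≟ v
      ... | yes p | yes q rewrite p | q | Av = +≤+ z≤n
      ... | no _  | no _ with A (t e) | A (h e)
      ... | true  | true  = +≤+ z≤n
      ... | true  | false = +≤+ z≤n
      ... | false | true  = +≤+ z≤n
      ... | false | false = +≤+ z≤n
      pointwise e | yes p | no q rewrite p | Av with A (h e) in Ah
      ... | true  = contradiction (only (h e) Ah) q
      ... | false = +≤+ z≤n
      pointwise e | no p | yes q rewrite q | Av with A (t e) in At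
      ... | true  = contradiction (only (t e) At) p
      ... | false = +≤+ z≤n
      rearr : ∀ a l → 1ℤ * a + (+ 2 * l + (-1ℤ * + 3 + 0ℤ)) ≡ a + + 2 * l - + 3
      rearr = solve-∀
      collect : total c ≡ cut A + + 2 * loops v - + 3
      collect = trans (cong (λ i → 1ℤ * cut A + (+ 2 * loops v + (-1ℤ * i + 0ℤ))) (∑-incidence v)) (rearr (cut A) (loops v))

  even≤1 : ∀ l → + 2 * l ≤ 1ℤ → l ≤ 0ℤ
  even≤1 (+ zero)    _ = ≤-refl
  even≤1 -[1+ _ ]    _ = -≤+
  even≤1 (+ suc l)   (+≤+ p) = contradiction (subst (ℕ._≤ 1) (cong ℕ.suc (ℕ.+-suc l _)) p) λ { (s≤s ()) }

  -- An induced forest can be pruned vertex by vertex, each time losing an edge of the cut.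
  circuit-or-cut : ∀ k A → card A ≤ + k → ∀ u → A u ≡ true → HasCircuit A ⊎ card A + + 2 ≤ cut A
  circuit-or-cut k A small u Au with any? (λ v → (A v Bool.≟ true) ×-dec (inner-degree A v ℤ.≤? 1ℤ))
  ... | no none = inj₁ (circuit-in-rich A Au (λ v Av → ℤ.i<j⇒suc[i]≤j (ℤ.≰⇒> (λ d≤1 → none (v , Av , d≤1)))))
  ... | yes (v , Av , d≤1) with any? (λ w → remove A v w Bool.≟ true)
  -- The last vertex: inner degree at most 1 excludes loops, so all three edges at `v` cross, and 3
  -- = 1 + 2.
  ... | no none = inj₂ (ungap (by (rearr (cut A) (loops v) (card A) (card (remove A v)))
      (gap singleton-cut ⊞ gap (even≤1 (loops v) few) ⊞ gap (even≤1 (loops v) few) ⊞ gap (≤-reflexive (card-remove A v Av)) ⊞ gap (≤-reflexive empty))))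
    where
    only : ∀ w → A w ≡ true → w ≡ v
    only w Aw with w ≟ v in eq
    ... | yes w≡v = w≡v
    ... | no _    = contradiction (w , cong₂ _∧_ Aw (cong (not ∘ does) eq)) none
    open Singleton A v Av only
    few : + 2 * loops v ≤ 1ℤ
    few = subst (_≤ 1ℤ) singleton-inner-degree d≤1
    empty : card (remove A v) ≡ 0ℤ
    empty = ∑-0 (λ w → cong ⟦_⟧ (Bool.¬-not (λ r → none (w , r))))
    rearr : ∀ c l a r → c + + 2 * l - + 3 + (0ℤ - l) + (0ℤ - l) + (r + 1ℤ - a) + (0ℤ - r) ≡ c - (a + + 2)
    rearr = solve-∀
  circuit-or-cut zero A small u Au | yes (v , Av , d≤1) | yes (w , A′w) =
    contradiction (≤-trans (term≤∑ (λ u → ⟦⟧-nonneg (A u)) u) small) (λ Au≤0 → ≤⇒≯ (subst (_≤ 0ℤ) (cong ⟦_⟧ Au) Au≤0))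
    where
    ≤⇒≯ : ¬ (1ℤ ≤ 0ℤ)
    ≤⇒≯ (+≤+ ())
  circuit-or-cut (suc k) A small u Au | yes (v , Av , d≤1) | yes (w , A′w)
    with circuit-or-cut k (remove A v) (ungap (by (shrink (card A) (card (remove A v)) (+ k)) (gap small ⊞ gap (≤-reflexive (sym (card-remove A v Av)))))) w A′w
    where
    shrink : ∀ a r k → 1ℤ + k - a + (a - (r + 1ℤ)) ≡ k - r
    shrink = solve-∀
  ... | inj₁ circuit = inj₁ (HasCircuit-mono (remove⊆ A v) circuit)
  -- With `d ≤ 1`, the change `2d - 3` of the cut is at most -1, which matches the loss of one
  -- vertex.
  ... | inj₂ bound = inj₂ (ungap (by (rearr (cut A) (cut (remove A v)) (inner-degree A v) (card A) (card (remove A v)))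
      (gap bound ⊞ gap (cut-remove A v Av) ⊞ gap d≤1 ⊞ gap d≤1 ⊞ gap (≤-reflexive (card-remove A v Av)))))
    where
    rearr : ∀ c c′ d a r → c′ - (r + + 2) + (c + + 2 * d - + 3 - c′) + (1ℤ - d) + (1ℤ - d) + (r + 1ℤ - a) ≡ c - (a + + 2)
    rearr = solve-∀

  module _ (connected : CyclicallyEdgeConnected G 6) where

    -- Deleting the edges that cross `A` keeps both circuits, and no remaining walk changes sides.
    -- So the circuits lie in different components, and fewer than 6 edges separate them.
    no-small-cyclic-cut : ∀ A → cut A ≤ + 5 → HasCircuit A → HasCircuit (not ∘ A) → ⊥
    no-small-cyclic-cut A small circuit circuit′ =
      connected (X , (u , u′ , separated) , X<6 , u , u′ , separated , (c , own-component c) , (c′ , own-component c′))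
      where
      X : Subset size
      X = tabulate (crosses A)
      F : Subset size
      F = ∁ X
      lookup-F : ∀ e → lookup F e ≡ not (crosses A e)
      lookup-F e = trans (lookup-map e not X) (cong not (lookup∘tabulate (crosses A) e))
      inner⇒F : ∀ e → inner A e ≡ true → e ∈ₛ F
      inner⇒F e i = lookup⇒[]= e F (trans (lookup-F e) (helper (A (t e)) (A (h e)) i))
        where
        helper : ∀ a b → a ∧ b ≡ true → not (a xor b) ≡ true
        helper true true _ = refl
      inner⇒F′ : ∀ e → inner (not ∘ A) e ≡ true → e ∈ₛ F
      inner⇒F′ e i = lookup⇒[]= e F (trans (lookup-F e) (helper (A (t e)) (A (h e)) i))
        where
        helper : ∀ a b → not a ∧ not b ≡ true → not (a xor b) ≡ true
        helper false false _ = refl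
      c = proj₁ (circuit F inner⇒F)
      c′ = proj₁ (circuit′ F inner⇒F′)
      u = Circuit.base c
      u′ = Circuit.base c′
      base-in : ∀ {B : Vertex → Bool} (d : Circuit G F) → All (λ v → B v ≡ true) (walkVertices G (Circuit.walk d)) → B (Circuit.base d) ≡ true
      base-in d inside with Circuit.walk d | Circuit.nonempty d
      base-in d inside        | stop         | nonempty = contradiction refl nonempty
      base-in d (Bb ∷ inside) | step _ _ _ _ | _        = Bb
      same-side : ∀ {v w} → Walk G F v w → A v ≡ A w
      same-side stop = refl
      same-side (step {v = v} e e∈F j p) = trans (edge-side j) (same-side p)
        where
        equal : A (t e) ≡ A (h e)
        equal = helper (A (t e)) (A (h e)) (trans (sym (lookup-F e)) ([]=⇒lookup e∈F))
          where
          helper : ∀ a b → not (a xor b) ≡ true → a ≡ b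
          helper true  true  _ = refl
          helper false false _ = refl
        edge-side : ∀ {x y} → Joins G e x y → A x ≡ A y
        edge-side (inj₁ refl) = equal
        edge-side (inj₂ refl) = sym equal
      separated : ¬ Walk G F u u′
      separated p = contradiction (base-in c′ (proj₂ (circuit′ F inner⇒F′)))
        (λ A′u′ → contradiction (trans (sym A′u′) (cong not (trans (sym (same-side p)) (base-in c (proj₂ (circuit F inner⇒F)))))) λ ())
      reach-all : ∀ {v w} (p : Walk G F v w) → All (component G F v) (walkVertices G p)
      reach-all stop = []
      reach-all (step e e∈F j p) = stop ∷ All.map (step e e∈F j) (reach-all p)
      own-component : ∀ (d : Circuit G F) → All (component G F (Circuit.base d)) (walkVertices G (Circuit.walk d))
      own-component d = reach-all (Circuit.walk d)
      X<6 : ∣ X ∣ₛ ℕ.< 6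
      X<6 = s≤s (ℤ.drop‿+≤+ (≤-trans (≤-reflexive (trans (sym (∑-lookup X)) (∑-cong (λ e → cong ⟦_⟧ (lookup∘tabulate (crosses A) e))))) small))

-- The 4-flow of two 1-factors, edge by edge

-- The state of an edge: m₁ and m₂ tell whether it lies in M₁ and M₂, x and y
-- are its directions in the even subgraphs M₁ Δ M₂ and E ∖ M₁.  The arguments a
-- and c tell whether its two ends lie in a given vertex set, and ε directs the
-- edges of M₁ ∩ M₂, where the 4-flow vanishes.
module _ (m₁ m₂ x y : Bool) where

  four-flow : ℤ
  four-flow = + 2 * (⟦ not m₁ ⟧ * sgn y) + 1ℤ * (⟦ m₁ xor m₂ ⟧ * sgn x)

  forward : Bool
  forward = if m₁ then x else y

  direct : Bool → Bool
  direct ε = if m₁ ∧ m₂ then ε else forward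

  leaves enters : Bool → Bool → Bool
  leaves a c = not (m₁ ∧ m₂) ∧ (if forward then a ∧ not c else c ∧ not a)
  enters a c = not (m₁ ∧ m₂) ∧ (if forward then c ∧ not a else a ∧ not c)

entersWith : Bool → Bool → Bool → Bool
entersWith ε a c = if ε then c ∧ not a else a ∧ not c

weight : Bool → Bool → Bool → Bool → Bool → Bool → ℤ
weight m₁ m₂ x y a c = + 4 * ⟦ leaves m₁ m₂ x y a c ⟧ + -1ℤ * ⟦ enters m₁ m₂ x y a c ⟧

-- For a leaving edge this is 3 minus its absolute flow value, for an entering edge that value minus
-- 1, and 0 for all others. It is written in the shape of `at` for a combination of three functions.
slack : Bool → Bool → Bool → Bool → Bool → Bool → ℤ
slack m₁ m₂ x y a c =
  + 3 * ⟦ leaves m₁ m₂ x y a c ⟧ + (-1ℤ * ⟦ enters m₁ m₂ x y a c ⟧ + (-1ℤ * (four-flow m₁ m₂ x y * (⟦ a ⟧ - ⟦ c ⟧)) + 0ℤ))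

slack-nonneg : ∀ m₁ m₂ x y a c → 0ℤ ≤ slack m₁ m₂ x y a c
slack-nonneg = from-yes (∀-Bool? λ m₁ → ∀-Bool? λ m₂ → ∀-Bool? λ x → ∀-Bool? λ y → ∀-Bool? λ a → ∀-Bool? λ c →
  0ℤ ℤ.≤? slack m₁ m₂ x y a c)

-- The slack of a leaving or entering edge vanishes only if its flow value is 3 or
-- 1 respectively, whereas the edges outside M₁ ∪ M₂ carry ±2.
slack-zero : ∀ m₁ m₂ x y a c → slack m₁ m₂ x y a c ≡ 0ℤ → not m₁ ∧ not m₂ ≡ true → a xor c ≡ false
slack-zero = from-yes (∀-Bool? λ m₁ → ∀-Bool? λ m₂ → ∀-Bool? λ x → ∀-Bool? λ y → ∀-Bool? λ a → ∀-Bool? λ c →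
  (slack m₁ m₂ x y a c ℤ.≟ 0ℤ) →-dec ((not m₁ ∧ not m₂ Bool.≟ true) →-dec (a xor c Bool.≟ false)))

crossing-count : ∀ m₁ m₂ x y a c →
  ⟦ leaves m₁ m₂ x y a c ⟧ + ⟦ enters m₁ m₂ x y a c ⟧ + ⟦ (m₁ ∧ m₂) ∧ (a xor c) ⟧ ≡ ⟦ a xor c ⟧
crossing-count = from-yes (∀-Bool? λ m₁ → ∀-Bool? λ m₂ → ∀-Bool? λ x → ∀-Bool? λ y → ∀-Bool? λ a → ∀-Bool? λ c →
  ⟦ leaves m₁ m₂ x y a c ⟧ + ⟦ enters m₁ m₂ x y a c ⟧ + ⟦ (m₁ ∧ m₂) ∧ (a xor c) ⟧ ℤ.≟ ⟦ a xor c ⟧)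

enters-complement : ∀ m₁ m₂ x y a c → enters m₁ m₂ x y (not a) (not c) ≡ leaves m₁ m₂ x y a c
enters-complement = from-yes (∀-Bool? λ m₁ → ∀-Bool? λ m₂ → ∀-Bool? λ x → ∀-Bool? λ y → ∀-Bool? λ a → ∀-Bool? λ c →
  enters m₁ m₂ x y (not a) (not c) Bool.≟ leaves m₁ m₂ x y a c)

-- The count of leaving edges is submodular, and leaving minus entering is modular; `weight` is
-- three times the former plus the latter.
weight-submodular : ∀ m₁ m₂ x y a c a′ c′ →
  weight m₁ m₂ x y (a ∧ a′) (c ∧ c′) + weight m₁ m₂ x y (a ∨ a′) (c ∨ c′) ≤ weight m₁ m₂ x y a c + weight m₁ m₂ x y a′ c′
weight-submodular = from-yes (∀-Bool? λ m₁ → ∀-Bool? λ m₂ → ∀-Bool? λ x → ∀-Bool? λ y →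
  ∀-Bool? λ a → ∀-Bool? λ c → ∀-Bool? λ a′ → ∀-Bool? λ c′ →
  weight m₁ m₂ x y (a ∧ a′) (c ∧ c′) + weight m₁ m₂ x y (a ∨ a′) (c ∨ c′) ℤ.≤? weight m₁ m₂ x y a c + weight m₁ m₂ x y a′ c′)

-- Outside M₁ ∩ M₂ weight and capacity agree. An edge of M₁ ∩ M₂ has weight 0, and its capacity is
-- -1 if it enters, which the last term offsets, and nonnegative otherwise.
weight≤capacity : ∀ m₁ m₂ x y ε a c → let d = direct m₁ m₂ x y ε in
  weight m₁ m₂ x y a c ≤
  (if a then (if c then 0ℤ else upper d) else (if c then - lower d else 0ℤ)) + ⟦ (m₁ ∧ m₂) ∧ entersWith ε a c ⟧
weight≤capacity = from-yes (∀-Bool? λ m₁ → ∀-Bool? λ m₂ → ∀-Bool? λ x → ∀-Bool? λ y →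
  ∀-Bool? λ ε → ∀-Bool? λ a → ∀-Bool? λ c → let d = direct m₁ m₂ x y ε in
  weight m₁ m₂ x y a c ℤ.≤?
  (if a then (if c then 0ℤ else upper d) else (if c then - lower d else 0ℤ)) + ⟦ (m₁ ∧ m₂) ∧ entersWith ε a c ⟧)

-- Tight cuts

⟦⟧-injective : ∀ {a b} → ⟦ a ⟧ ≡ ⟦ b ⟧ → a ≡ b
⟦⟧-injective {false} {false} _ = refl
⟦⟧-injective {true}  {true}  _ = refl

some-true : ∀ {n} (f : Fin n → Bool) → 1ℤ ≤ ∑ (λ i → ⟦ f i ⟧) → ∃[ i ] f i ≡ true
some-true f one with any? (λ i → f i Bool.≟ true)
... | yes found = found
... | no none = contradiction (subst (1ℤ ≤_) (∑-0 (λ i → cong ⟦_⟧ (Bool.¬-not (λ p → none (i , p))))) one) λ { (+≤+ ()) }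

one≤∑ : ∀ {n} (f : Fin n → Bool) i → f i ≡ true → 1ℤ ≤ ∑ (λ i → ⟦ f i ⟧)
one≤∑ f i fi = subst (_≤ ∑ (λ i → ⟦ f i ⟧)) (cong ⟦_⟧ fi) (term≤∑ (λ i → ⟦⟧-nonneg (f i)) i)

module FiveFlow (G : Graph) (cubic : Cubic G) (connected : CyclicallyEdgeConnected G 6)
  (M₁ M₂ : Subset (Graph.size G)) (M₁-factor : OneFactor G M₁) (M₂-factor : OneFactor G M₂)
  (few : ∣ M₁ ∩ M₂ ∣ₛ ℕ.≤ 2) where
  open Graph G
  open Circuits G
  open Circulation t h
  open Degrees t h
  open Cuts G cubic

  m₁ m₂ both neither : Edge → Bool
  m₁ = lookup M₁
  m₂ = lookup M₂
  both e = m₁ e ∧ m₂ e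
  neither e = not (m₁ e) ∧ not (m₂ e)

  both≤2 : ∑ (λ e → ⟦ both e ⟧) ≤ + 2
  both≤2 = ≤-trans (≤-reflexive (trans (∑-cong (λ e → cong ⟦_⟧ (sym (lookup-zipWith _∧_ e M₁ M₂)))) (∑-lookup (M₁ ∩ M₂)))) (+≤+ few)

  deg-m₁ : ∀ v → deg (λ e → ⟦ m₁ e ⟧) v ≡ 1ℤ
  deg-m₁ v = trans (sym (degree-deg G M₁ v)) (cong +_ (M₁-factor v))

  deg-m₂ : ∀ v → deg (λ e → ⟦ m₂ e ⟧) v ≡ 1ℤ
  deg-m₂ v = trans (sym (degree-deg G M₂ v)) (cong +_ (M₂-factor v))

  deg-one : ∀ v → deg (λ _ → 1ℤ) v ≡ + 3
  deg-one v = trans (deg-as-∑ (λ _ → 1ℤ) v) (trans (∑-cong (λ e → ℤ.*-identityˡ _)) (∑-incidence v))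

  deg-xor : ∀ v → deg (λ e → ⟦ m₁ e xor m₂ e ⟧) v ≡ + 2 * (1ℤ - deg (λ e → ⟦ both e ⟧) v)
  deg-xor v = begin
    deg (λ e → ⟦ m₁ e xor m₂ e ⟧) v
      ≡⟨ deg-cong pointwise v ⟩
    deg (λ e → 1ℤ * (1ℤ * ⟦ m₁ e ⟧ + 1ℤ * ⟦ m₂ e ⟧) + - + 2 * ⟦ both e ⟧) v
      ≡⟨ deg-lin 1ℤ (λ e → 1ℤ * ⟦ m₁ e ⟧ + 1ℤ * ⟦ m₂ e ⟧) (- + 2) (λ e → ⟦ both e ⟧) v ⟩
    1ℤ * deg (λ e → 1ℤ * ⟦ m₁ e ⟧ + 1ℤ * ⟦ m₂ e ⟧) v + - + 2 * deg (λ e → ⟦ both e ⟧) v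
      ≡⟨ cong (λ d → 1ℤ * d + - + 2 * deg (λ e → ⟦ both e ⟧) v)
           (trans (deg-lin 1ℤ (λ e → ⟦ m₁ e ⟧) 1ℤ (λ e → ⟦ m₂ e ⟧) v) (cong₂ (λ p q → 1ℤ * p + 1ℤ * q) (deg-m₁ v) (deg-m₂ v))) ⟩
    1ℤ * + 2 + - + 2 * deg (λ e → ⟦ both e ⟧) v
      ≡⟨ rearr (deg (λ e → ⟦ both e ⟧) v) ⟩
    + 2 * (1ℤ - deg (λ e → ⟦ both e ⟧) v) ∎
    where
    open ≡-Reasoning
    rearr : ∀ d → 1ℤ * + 2 + - + 2 * d ≡ + 2 * (1ℤ - d)
    rearr = solve-∀
    pointwise : ∀ e → ⟦ m₁ e xor m₂ e ⟧ ≡ 1ℤ * (1ℤ * ⟦ m₁ e ⟧ + 1ℤ * ⟦ m₂ e ⟧) + - + 2 * ⟦ both e ⟧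
    pointwise e with m₁ e | m₂ e
    ... | true  | true  = refl
    ... | true  | false = refl
    ... | false | true  = refl
    ... | false | false = refl

  deg-not-m₁ : ∀ v → deg (λ e → ⟦ not (m₁ e) ⟧) v ≡ + 2 * 1ℤ
  deg-not-m₁ v = trans (deg-cong pointwise v) (trans (deg-lin 1ℤ (λ _ → 1ℤ) -1ℤ (λ e → ⟦ m₁ e ⟧) v)
    (cong₂ (λ p q → 1ℤ * p + -1ℤ * q) (deg-one v) (deg-m₁ v)))
    where
    pointwise : ∀ e → ⟦ not (m₁ e) ⟧ ≡ 1ℤ * 1ℤ + -1ℤ * ⟦ m₁ e ⟧
    pointwise e with m₁ e
    ... | true  = refl
    ... | false = refl

  opaque
    x-flow : ∃ λ (x : Edge → Bool) → ∀ v → net (λ e → ⟦ m₁ e xor m₂ e ⟧ * sgn (x e)) v ≡ 0ℤ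
    x-flow = even-flow (λ e → m₁ e xor m₂ e) (λ v → 1ℤ - deg (λ e → ⟦ both e ⟧) v) deg-xor

    y-flow : ∃ λ (y : Edge → Bool) → ∀ v → net (λ e → ⟦ not (m₁ e) ⟧ * sgn (y e)) v ≡ 0ℤ
    y-flow = even-flow (λ e → not (m₁ e)) (λ _ → 1ℤ) deg-not-m₁

  x y : Edge → Bool
  x = proj₁ x-flow
  y = proj₁ y-flow

  flow : Edge → ℤ
  flow e = four-flow (m₁ e) (m₂ e) (x e) (y e)

  net-flow : ∀ v → net flow v ≡ 0ℤ
  net-flow v = trans (net-lin (+ 2) (λ e → ⟦ not (m₁ e) ⟧ * sgn (y e)) 1ℤ (λ e → ⟦ m₁ e xor m₂ e ⟧ * sgn (x e)) v)
    (cong₂ (λ p q → + 2 * p + 1ℤ * q) (proj₂ y-flow v) (proj₂ x-flow v))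

  VertexSet : Set
  VertexSet = Vertex → Bool

  out ins : VertexSet → Edge → Bool
  out X e = leaves (m₁ e) (m₂ e) (x e) (y e) (X (t e)) (X (h e))
  ins X e = enters (m₁ e) (m₂ e) (x e) (y e) (X (t e)) (X (h e))

  P Q : VertexSet → ℤ
  P X = ∑ (λ e → ⟦ out X e ⟧)
  Q X = ∑ (λ e → ⟦ ins X e ⟧)

  through : VertexSet → Edge → ℤ
  through X e = flow e * (⟦ X (t e) ⟧ - ⟦ X (h e) ⟧)

  ∑-through : ∀ X → ∑ (through X) ≡ 0ℤ
  ∑-through X = trans (sym (net-pairing flow (λ v → ⟦ X v ⟧)))
    (∑-0 (λ v → trans (cong (_*_ ⟦ X v ⟧) (net-flow v)) (ℤ.*-zeroʳ ⟦ X v ⟧)))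

  P-nonneg : ∀ X → 0ℤ ≤ P X
  P-nonneg X = ∑-nonneg (λ e → ⟦⟧-nonneg (out X e))

  slacks : VertexSet → Combination size
  slacks X = (+ 3 , λ e → ⟦ out X e ⟧) ∷ (-1ℤ , λ e → ⟦ ins X e ⟧) ∷ (-1ℤ , through X) ∷ []

  slacks-nonneg : ∀ X e → 0ℤ ≤ at (slacks X) e
  slacks-nonneg X e = slack-nonneg (m₁ e) (m₂ e) (x e) (y e) (X (t e)) (X (h e))

  total-slacks : ∀ X → total (slacks X) ≡ + 3 * P X - Q X
  total-slacks X = trans (cong (λ s → + 3 * P X + (-1ℤ * Q X + (-1ℤ * s + 0ℤ))) (∑-through X)) (rearr (P X) (Q X))
    where
    rearr : ∀ p q → + 3 * p + (-1ℤ * q + (-1ℤ * 0ℤ + 0ℤ)) ≡ + 3 * p - q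
    rearr = solve-∀

  -- The flow leaving `X` equals the flow entering it; each leaving edge carries at most 3 and each
  -- entering edge at least 1.
  Q≤3P : ∀ X → 0ℤ ≤ + 3 * P X - Q X
  Q≤3P X = by (total-slacks X) (total-nonneg (slacks X) (slacks-nonneg X))

  cut-decomposition : ∀ X → cut X ≡ P X + Q X + ∑ (λ e → ⟦ both e ∧ crosses X e ⟧)
  cut-decomposition X = begin
    cut X
      ≡⟨ ∑-cong (λ e → crossing-count (m₁ e) (m₂ e) (x e) (y e) (X (t e)) (X (h e))) ⟨
    ∑ (λ e → ⟦ out X e ⟧ + ⟦ ins X e ⟧ + ⟦ both e ∧ crosses X e ⟧)
      ≡⟨ ∑-+ (λ e → ⟦ out X e ⟧ + ⟦ ins X e ⟧) (λ e → ⟦ both e ∧ crosses X e ⟧) ⟩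
    ∑ (λ e → ⟦ out X e ⟧ + ⟦ ins X e ⟧) + ∑ (λ e → ⟦ both e ∧ crosses X e ⟧)
      ≡⟨ cong (_+ (∑ (λ e → ⟦ both e ∧ crosses X e ⟧))) (∑-+ (λ e → ⟦ out X e ⟧) (λ e → ⟦ ins X e ⟧)) ⟩
    P X + Q X + ∑ (λ e → ⟦ both e ∧ crosses X e ⟧) ∎
    where open ≡-Reasoning

  cut-complement : ∀ X → cut (not ∘ X) ≡ cut X
  cut-complement X = ∑-cong (λ e → cong ⟦_⟧ (xor-not (X (t e)) (X (h e))))
    where
    xor-not : ∀ a c → not a xor not c ≡ a xor c
    xor-not true  true  = refl
    xor-not true  false = refl
    xor-not false true  = refl
    xor-not false false = refl

  circuit-or-small : ∀ X k → cut X ≤ k → ∀ u → X u ≡ true → HasCircuit X ⊎ card X + + 2 ≤ k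
  circuit-or-small X k cut≤k u Xu =
    Sum.map₂ (λ small → ≤-trans small cut≤k)
      (circuit-or-cut _ X (≤-reflexive (sym (ℤ.0≤i⇒+∣i∣≡i (∑-nonneg (λ v → ⟦⟧-nonneg (X v)))))) u Xu)

  -- If no edge leaves, then by `Q≤3P` none enters, and the cut consists of at most two edges of M₁
  -- ∩ M₂. A nonempty side inducing a forest would have at least three cut edges, so both sides
  -- contain circuits, against cyclic connectivity.
  P-positive : ∀ X {u v} → X u ≡ true → X v ≡ false → 1ℤ ≤ P X
  P-positive X {u} {v} Xu Xv with 1ℤ ℤ.≤? P X
  ... | yes 1≤P = 1≤P
  ... | no 1≰P = ⊥-elim separates
    where
    both-crossing : ∑ (λ e → ⟦ both e ∧ crosses X e ⟧) ≤ ∑ (λ e → ⟦ both e ⟧)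
    both-crossing = ∑-mono pointwise
      where
      pointwise : ∀ e → ⟦ both e ∧ crosses X e ⟧ ≤ ⟦ both e ⟧
      pointwise e with both e | crosses X e
      ... | true  | true  = ≤-refl
      ... | true  | false = +≤+ z≤n
      ... | false | _     = ≤-refl
    P≤0 : 0ℤ ≤ 0ℤ - P X
    P≤0 = by (rearr (P X)) (strict-gap (ℤ.≰⇒> 1≰P))
      where
      rearr : ∀ p → 1ℤ - p - 1ℤ ≡ 0ℤ - p
      rearr = solve-∀
    cut≤2 : cut X ≤ + 2
    cut≤2 = subst (_≤ + 2) (sym (cut-decomposition X)) (ungap (by (rearr (P X) (Q X) (∑ (λ e → ⟦ both e ∧ crosses X e ⟧)) (∑ (λ e → ⟦ both e ⟧)))
      (P≤0 ⊞ P≤0 ⊞ P≤0 ⊞ P≤0 ⊞ Q≤3P X ⊞ gap both-crossing ⊞ gap both≤2)))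
      where
      rearr : ∀ p q b b′ → 0ℤ - p + (0ℤ - p) + (0ℤ - p) + (0ℤ - p) + (+ 3 * p - q) + (b′ - b) + (+ 2 - b′) ≡ + 2 - (p + q + b)
      rearr = solve-∀
    nonempty : ∀ (Y : VertexSet) w → Y w ≡ true → ¬ (card Y + + 2 ≤ + 2)
    nonempty Y w Yw small = 0≰-1 (by (rearr (card Y)) (gap small ⊞ gap (one≤∑ Y w Yw)))
      where
      rearr : ∀ k → + 2 - (k + + 2) + (k - 1ℤ) ≡ -1ℤ
      rearr = solve-∀
    separates : ⊥
    separates = [ (λ circuit → [ no-small-cyclic-cut connected X (≤-trans cut≤2 (+≤+ (s≤s (s≤s z≤n)))) circuit
                               , nonempty (not ∘ X) v (cong not Xv)
                               ]′ (circuit-or-small (not ∘ X) (+ 2) (≤-trans (≤-reflexive (cut-complement X)) cut≤2) v (cong not Xv)))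
                , nonempty X u Xu
                ]′ (circuit-or-small X (+ 2) cut≤2 u Xu)

  complement : VertexSet → VertexSet
  complement X v = not (X v)

  infixr 7 _∩′_
  infixr 6 _∪′_
  _∩′_ _∪′_ : VertexSet → VertexSet → VertexSet
  (X ∩′ Y) v = X v ∧ Y v
  (X ∪′ Y) v = X v ∨ Y v

  -- `4P - Q` is the capacity of `X` on the edges outside M₁ ∩ M₂. Each of the at most two common
  -- edges lowers the capacity by at most 1, so a negative total forces this bound.
  Tight : VertexSet → Set
  Tight X = + 4 * P X - Q X ≤ 1ℤ

  module TightCut (X : VertexSet) (tight : Tight X) (1≤P : 1ℤ ≤ P X) where

    -- By `Q≤3P`, `4P - Q` is at least `P`.
    P≡1 : P X ≡ 1ℤ
    P≡1 = ≤-antisym (ungap (by (rearr (P X) (Q X)) (gap tight ⊞ Q≤3P X))) 1≤P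
      where
      rearr : ∀ p q → 1ℤ - (+ 4 * p - q) + (+ 3 * p - q) ≡ 1ℤ - p
      rearr = solve-∀

    Q≡3 : Q X ≡ + 3
    Q≡3 = ≤-antisym
      (ungap (subst (λ p → 0ℤ ≤ + 3 * p - Q X) P≡1 (Q≤3P X)))
      (ungap (by (rearr (Q X)) (subst (λ p → 0ℤ ≤ 1ℤ - (+ 4 * p - Q X)) P≡1 (gap tight))))
      where
      rearr : ∀ q → 1ℤ - (+ 4 * 1ℤ - q) ≡ q - + 3
      rearr = solve-∀

    -- Now `Q = 3P`, so the slacks across `X` sum to 0 and each of them vanishes, which `slack-zero`
    -- excludes for a crossing edge with flow ±2.
    neither-inside : ∀ e → neither e ≡ true → crosses X e ≡ false
    neither-inside e = slack-zero (m₁ e) (m₂ e) (x e) (y e) (X (t e)) (X (h e))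
      (at-zero (slacks X) (slacks-nonneg X) (≤-reflexive (trans (total-slacks X) (cong₂ (λ p q → + 3 * p - q) P≡1 Q≡3))) e)

  submodular : ∀ X Y → 0ℤ ≤ + 4 * P X - Q X + (+ 4 * P Y - Q Y)
    - (+ 4 * P (X ∩′ Y) - Q (X ∩′ Y)) - (+ 4 * P (X ∪′ Y) - Q (X ∪′ Y))
  submodular X Y = by (rearr (P X) (Q X) (P Y) (Q Y) (P (X ∩′ Y)) (Q (X ∩′ Y)) (P (X ∪′ Y)) (Q (X ∪′ Y)))
    (total-nonneg c pointwise)
    where
    term : ℤ → (VertexSet → Edge → Bool) → VertexSet → ℤ × (Edge → ℤ)
    term a f Z = a , λ e → ⟦ f Z e ⟧
    c : Combination size
    c = term (+ 4) out X ∷ term -1ℤ ins X ∷ term (+ 4) out Y ∷ term -1ℤ ins Y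
      ∷ term (- + 4) out (X ∩′ Y) ∷ term 1ℤ ins (X ∩′ Y) ∷ term (- + 4) out (X ∪′ Y) ∷ term 1ℤ ins (X ∪′ Y) ∷ []
    rearr : ∀ a b c d e f g i →
      + 4 * a + (-1ℤ * b + (+ 4 * c + (-1ℤ * d + (- + 4 * e + (1ℤ * f + (- + 4 * g + (1ℤ * i + 0ℤ)))))))
      ≡ + 4 * a - b + (+ 4 * c - d) - (+ 4 * e - f) - (+ 4 * g - i)
    rearr = solve-∀
    rearr′ : ∀ a b c d e f g i →
      + 4 * a + -1ℤ * b + (+ 4 * c + -1ℤ * d) - (+ 4 * e + -1ℤ * f + (+ 4 * g + -1ℤ * i))
      ≡ + 4 * a + (-1ℤ * b + (+ 4 * c + (-1ℤ * d + (- + 4 * e + (1ℤ * f + (- + 4 * g + (1ℤ * i + 0ℤ)))))))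
    rearr′ = solve-∀
    pointwise : ∀ e → 0ℤ ≤ at c e
    pointwise e = by (rearr′ ⟦ out X e ⟧ ⟦ ins X e ⟧ ⟦ out Y e ⟧ ⟦ ins Y e ⟧ ⟦ out (X ∩′ Y) e ⟧ ⟦ ins (X ∩′ Y) e ⟧ ⟦ out (X ∪′ Y) e ⟧ ⟦ ins (X ∪′ Y) e ⟧)
      (gap (weight-submodular (m₁ e) (m₂ e) (x e) (y e) (X (t e)) (X (h e)) (Y (t e)) (Y (h e))))

  cut≤3card : ∀ S → cut S ≤ + 3 * card S
  cut≤3card S = ≤-trans (∑-mono pointwise) (≤-reflexive (trans (sym (deg-pairing (λ _ → 1ℤ) (λ v → ⟦ S v ⟧)))
      (trans (∑-cong (λ v → trans (cong (_*_ ⟦ S v ⟧) (deg-one v)) (ℤ.*-comm ⟦ S v ⟧ (+ 3)))) (∑-* (+ 3) (λ v → ⟦ S v ⟧)))))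
    where
    pointwise : ∀ e → ⟦ crosses S e ⟧ ≤ 1ℤ * (⟦ S (t e) ⟧ + ⟦ S (h e) ⟧)
    pointwise e with S (t e) | S (h e)
    ... | true  | true  = +≤+ z≤n
    ... | true  | false = ≤-refl
    ... | false | true  = ≤-refl
    ... | false | false = ≤-refl

  two-vertices : ∀ S → + 4 ≤ cut S → + 2 ≤ card S
  two-vertices S big with + 2 ℤ.≤? card S
  ... | yes 2≤card = 2≤card
  ... | no 2≰card = ⊥-elim (0≰-1 (by (rearr (cut S) (card S)) (gap big ⊞ gap (cut≤3card S) ⊞ less ⊞ less ⊞ less)))
    where
    less : 0ℤ ≤ + 2 - card S - 1ℤ
    less = strict-gap (ℤ.≰⇒> 2≰card)
    rearr : ∀ c k → c - + 4 + (+ 3 * k - c) + (+ 2 - k - 1ℤ) + (+ 2 - k - 1ℤ) + (+ 2 - k - 1ℤ) ≡ -1ℤ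
    rearr = solve-∀

  -- A forest on four or more vertices has at least 6 cut edges, so the complement of `A` contains a
  -- circuit. Then `A` contains none, and a forest with at most 5 cut edges has at most 3 vertices.
  small-side : ∀ A {u v} → A u ≡ true → A v ≡ false → cut A ≤ + 5 → + 4 ≤ card (complement A) →
    ¬ HasCircuit A × card A ≤ + 3
  small-side A {u} {v} Au Av cut≤5 4≤card = acyclic , [ (λ c → ⊥-elim (acyclic c)) , bound ]′ (circuit-or-small A (+ 5) cut≤5 u Au)
    where
    bound : ∀ {k} → k + + 2 ≤ + 5 → k ≤ + 3
    bound {k} p = ungap (by (rearr k) (gap p))
      where
      rearr : ∀ k → + 5 - (k + + 2) ≡ + 3 - k
      rearr = solve-∀
    large : ¬ (card (complement A) + + 2 ≤ + 5)
    large p = 0≰-1 (by (rearr (card (complement A))) (gap p ⊞ gap 4≤card))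
      where
      rearr : ∀ k → + 5 - (k + + 2) + (k - + 4) ≡ -1ℤ
      rearr = solve-∀
    acyclic : ¬ HasCircuit A
    acyclic circuit = [ no-small-cyclic-cut connected A cut≤5 circuit , large ]′
      (circuit-or-small (complement A) (+ 5) (≤-trans (≤-reflexive (cut-complement A)) cut≤5) v (cong not Av))

  -- Uncrossing two tight cuts

  module Uncross (X Y : VertexSet) (tight-X : Tight X) (tight-Y : Tight Y) (e₁ : Edge)
    (others : ∀ e → both e ≡ true → e ≢ e₁ → crosses (X ∩′ Y) e ≡ false × crosses (X ∪′ Y) e ≡ false)
    {p q r s : Vertex} (p∈ : X p ≡ true × Y p ≡ true) (q∈ : X q ≡ true × Y q ≡ false)
    (r∈ : X r ≡ false × Y r ≡ true) (s∈ : X s ≡ false × Y s ≡ false) where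

    -- `p` and `s` show that both sets are nonempty and proper, as `P-positive` requires; `q` and
    -- `r` inhabit the two differences, which enlarge the complement of `A` and the set `B`.
    A B : VertexSet
    A = X ∩′ Y
    B = X ∪′ Y

    Ap : A p ≡ true
    Ap = cong₂ _∧_ (proj₁ p∈) (proj₂ p∈)

    As : A s ≡ false
    As = cong₂ _∧_ (proj₁ s∈) (proj₂ s∈)

    Bp : B p ≡ true
    Bp = cong₂ _∨_ (proj₁ p∈) (proj₂ p∈)

    Bs : B s ≡ false
    Bs = cong₂ _∨_ (proj₁ s∈) (proj₂ s∈)

    1≤PA : 1ℤ ≤ P A
    1≤PA = P-positive A Ap As

    1≤PB : 1ℤ ≤ P B
    1≤PB = P-positive B Bp Bs

    -- By submodularity the values of `4P - Q` at `A` and `B` sum to at most 2, and the one at `B`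
    -- is at least `P B`, hence at least 1.
    tight-A : Tight A
    tight-A = ungap (by (rearr (P X) (Q X) (P Y) (Q Y) (P A) (Q A) (P B) (Q B))
      (gap tight-X ⊞ gap tight-Y ⊞ submodular X Y ⊞ Q≤3P B ⊞ gap 1≤PB))
      where
      rearr : ∀ a b c d e f g i → 1ℤ - (+ 4 * a - b) + (1ℤ - (+ 4 * c - d))
        + (+ 4 * a - b + (+ 4 * c - d) - (+ 4 * e - f) - (+ 4 * g - i)) + (+ 3 * g - i) + (g - 1ℤ) ≡ 1ℤ - (+ 4 * e - f)
      rearr = solve-∀

    tight-B : Tight B
    tight-B = ungap (by (rearr (P X) (Q X) (P Y) (Q Y) (P A) (Q A) (P B) (Q B))
      (gap tight-X ⊞ gap tight-Y ⊞ submodular X Y ⊞ Q≤3P A ⊞ gap 1≤PA))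
      where
      rearr : ∀ a b c d e f g i → 1ℤ - (+ 4 * a - b) + (1ℤ - (+ 4 * c - d))
        + (+ 4 * a - b + (+ 4 * c - d) - (+ 4 * e - f) - (+ 4 * g - i)) + (+ 3 * e - f) + (e - 1ℤ) ≡ 1ℤ - (+ 4 * g - i)
      rearr = solve-∀

    module TA = TightCut A tight-A 1≤PA
    module TB = TightCut B tight-B 1≤PB

    cut≤5 : ∀ S → P S ≡ 1ℤ → Q S ≡ + 3 → (∀ e → both e ≡ true → e ≢ e₁ → crosses S e ≡ false) → cut S ≤ + 5
    cut≤5 S PS QS rest = ≤-trans (≤-reflexive (trans (cut-decomposition S) (cong₂ (λ a b → a + b + ∑ (λ e → ⟦ both e ∧ crosses S e ⟧)) PS QS)))
      (ℤ.+-monoʳ-≤ (+ 4) (≤-trans (∑-mono pointwise) (≤-reflexive (∑-δ e₁))))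
      where
      pointwise : ∀ e → ⟦ both e ∧ crosses S e ⟧ ≤ ⟦ e₁ == e ⟧
      pointwise e with e₁ ≟ e | both e in be | crosses S e in ce
      ... | yes _ | true  | true  = ≤-refl
      ... | yes _ | true  | false = +≤+ z≤n
      ... | yes _ | false | _     = +≤+ z≤n
      ... | no _  | false | _     = ≤-refl
      ... | no _  | true  | false = ≤-refl
      ... | no ≢e | true  | true  = contradiction (trans (sym ce) (rest e be (λ e≡ → ≢e (sym e≡)))) λ ()

    4≤cut : ∀ S → P S ≡ 1ℤ → Q S ≡ + 3 → + 4 ≤ cut S
    4≤cut S PS QS = ≤-trans (ℤ.+-monoʳ-≤ (+ 4) (∑-nonneg (λ e → ⟦⟧-nonneg (both e ∧ crosses S e))))
      (≤-reflexive (sym (trans (cut-decomposition S) (cong₂ (λ a b → a + b + ∑ (λ e → ⟦ both e ∧ crosses S e ⟧)) PS QS))))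

    cut-A≤5 : cut A ≤ + 5
    cut-A≤5 = cut≤5 A TA.P≡1 TA.Q≡3 (λ e be e≢ → proj₁ (others e be e≢))

    cut-B≤5 : cut B ≤ + 5
    cut-B≤5 = cut≤5 B TB.P≡1 TB.Q≡3 (λ e be e≢ → proj₂ (others e be e≢))

    2≤card-A : + 2 ≤ card A
    2≤card-A = two-vertices A (4≤cut A TA.P≡1 TA.Q≡3)

    2≤card-B′ : + 2 ≤ card (complement B)
    2≤card-B′ = two-vertices (complement B) (≤-trans (4≤cut B TB.P≡1 TB.Q≡3) (≤-reflexive (sym (cut-complement B))))

    1≤card-X∖Y : 1ℤ ≤ card (X ∩′ complement Y)
    1≤card-X∖Y = one≤∑ (X ∩′ complement Y) q (cong₂ (λ a b → a ∧ not b) (proj₁ q∈) (proj₂ q∈))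

    1≤card-Y∖X : 1ℤ ≤ card (complement X ∩′ Y)
    1≤card-Y∖X = one≤∑ (complement X ∩′ Y) r (cong₂ (λ a b → not a ∧ b) (proj₁ r∈) (proj₂ r∈))

    three-parts : ∀ {S T U : VertexSet} → + 2 ≤ card S → 1ℤ ≤ card T → 1ℤ ≤ card U → ∀ W →
      (∀ v → ⟦ S v ⟧ + (⟦ T v ⟧ + ⟦ U v ⟧) ≤ ⟦ W v ⟧) → + 4 ≤ card W
    three-parts {S} {T} {U} 2≤ 1≤ 1≤′ W parts = ≤-trans (+-mono-≤ 2≤ (+-mono-≤ 1≤ 1≤′))
      (≤-trans (≤-reflexive (sym (trans (∑-+ (λ v → ⟦ S v ⟧) (λ v → ⟦ T v ⟧ + ⟦ U v ⟧)) (cong (_+_ (card S)) (∑-+ (λ v → ⟦ T v ⟧) (λ v → ⟦ U v ⟧))))))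
        (∑-mono parts))

    -- The complement of `A` has at least four vertices: two outside `B`, since one vertex has only
    -- three edges, and one in each difference.
    side-A : ¬ HasCircuit A × card A ≤ + 3
    side-A = small-side A Ap As cut-A≤5 (three-parts 2≤card-B′ 1≤card-X∖Y 1≤card-Y∖X (complement A) parts)
      where
      parts : ∀ v → ⟦ complement B v ⟧ + (⟦ (X ∩′ complement Y) v ⟧ + ⟦ (complement X ∩′ Y) v ⟧) ≤ ⟦ complement A v ⟧
      parts v with X v | Y v
      ... | true  | true  = ≤-refl
      ... | true  | false = ≤-refl
      ... | false | true  = ≤-refl
      ... | false | false = ≤-refl

    side-B : ¬ HasCircuit (complement B) × card (complement B) ≤ + 3
    side-B = small-side (complement B) (cong not Bs) (cong not Bp) (≤-trans (≤-reflexive (cut-complement B)) cut-B≤5)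
      (three-parts 2≤card-A 1≤card-X∖Y 1≤card-Y∖X (complement (complement B)) parts)
      where
      parts : ∀ v → ⟦ A v ⟧ + (⟦ (X ∩′ complement Y) v ⟧ + ⟦ (complement X ∩′ Y) v ⟧) ≤ ⟦ complement (complement B) v ⟧
      parts v with X v | Y v
      ... | true  | true  = ≤-refl
      ... | true  | false = ≤-refl
      ... | false | true  = ≤-refl
      ... | false | false = ≤-refl

  -- Violations of Hoffman's condition

  direction : (Edge → Bool) → Edge → Bool
  direction ε e = direct (m₁ e) (m₂ e) (x e) (y e) (ε e)

  entering : (Edge → Bool) → VertexSet → Edge → Bool
  entering ε X e = entersWith (ε e) (X (t e)) (X (h e))

  -- What a violation of Hoffman's condition amounts to when the edges of
  -- M₁ ∩ M₂ are directed by ε.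
  record Bad (ε : Edge → Bool) (X : VertexSet) : Set where
    field
      tight  : Tight X
      enter  : ∀ e → both e ≡ true → entering ε X e ≡ true
      2≤both : + 2 ≤ ∑ (λ e → ⟦ both e ⟧)

  module _ (ε : Edge → Bool) where
    open Hoffman t h (λ e → lower (direction ε e)) (λ e → upper (direction ε e)) (λ _ → 0ℤ)

    entering-count : VertexSet → ℤ
    entering-count X = ∑ (λ e → ⟦ both e ∧ entering ε X e ⟧)

    entering≤both : ∀ X e → 0ℤ ≤ 1ℤ * ⟦ both e ⟧ + (-1ℤ * ⟦ both e ∧ entering ε X e ⟧ + 0ℤ)
    entering≤both X e with both e | entering ε X e
    ... | true  | true  = ≤-refl
    ... | true  | false = +≤+ z≤n
    ... | false | _     = ≤-refl

    violated→bad : ∀ X → ∑ (capacity X) < ∑ (λ v → ⟦ X v ⟧ * 0ℤ) → Bad ε X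
    violated→bad X violated = record
      { tight  = ungap (by (tight-eq (P X) (Q X) (entering-count X) B) (gap over ⊞ entering≤total ⊞ gap both≤2))
      ; enter  = enter
      ; 2≤both = ungap (by (both-eq (P X) (Q X) (entering-count X) B) (gap over ⊞ Q≤3P X ⊞ gap 1≤P ⊞ entering≤total))
      }
      where
      B : ℤ
      B = ∑ (λ e → ⟦ both e ⟧)
      entering-combination : Combination size
      entering-combination = (1ℤ , λ e → ⟦ both e ⟧) ∷ (-1ℤ , λ e → ⟦ both e ∧ entering ε X e ⟧) ∷ []
      simplify : ∀ b i → 1ℤ * b + (-1ℤ * i + 0ℤ) ≡ b - i
      simplify = solve-∀
      entering≤total : 0ℤ ≤ B - entering-count X
      entering≤total = by (simplify B (entering-count X)) (total-nonneg entering-combination (entering≤both X))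
      weights : Combination size
      weights = (1ℤ , capacity X) ∷ (1ℤ , λ e → ⟦ both e ∧ entering ε X e ⟧) ∷ (- + 4 , λ e → ⟦ out X e ⟧) ∷ (1ℤ , λ e → ⟦ ins X e ⟧) ∷ []
      weights-nonneg : ∀ e → 0ℤ ≤ at weights e
      weights-nonneg e = by (rearr (capacity X e) ⟦ both e ∧ entering ε X e ⟧ ⟦ out X e ⟧ ⟦ ins X e ⟧)
        (gap (weight≤capacity (m₁ e) (m₂ e) (x e) (y e) (ε e) (X (t e)) (X (h e))))
        where
        rearr : ∀ c b p q → c + b - (+ 4 * p + -1ℤ * q) ≡ 1ℤ * c + (1ℤ * b + (- + 4 * p + (1ℤ * q + 0ℤ)))
        rearr = solve-∀
      -- The capacity is negative, hence at most -1, and adding the number of entering edges of M₁ ∩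
      -- M₂ raises it to at least `4P - Q`.
      over : + 4 * P X - Q X + 1ℤ ≤ entering-count X
      over = ungap (by (rearr (∑ (capacity X)) (entering-count X) (P X) (Q X))
        (total-nonneg weights weights-nonneg ⊞ strict-gap (subst (∑ (capacity X) <_) (∑-0 (λ v → ℤ.*-zeroʳ ⟦ X v ⟧)) violated)))
        where
        rearr : ∀ c i p q → 1ℤ * c + (1ℤ * i + (- + 4 * p + (1ℤ * q + 0ℤ))) + (0ℤ - c - 1ℤ) ≡ i - (+ 4 * p - q + 1ℤ)
        rearr = solve-∀
      -- As `4P - Q ≥ P ≥ 0`, at least one common edge enters. Its ends lie on different sides of
      -- `X`, which is what `P-positive` needs.
      some-entering : ∃[ e ] both e ∧ entering ε X e ≡ true
      some-entering = some-true _ (ungap (by (rearr (P X) (Q X) (entering-count X)) (gap over ⊞ Q≤3P X ⊞ P-nonneg X)))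
        where
        rearr : ∀ p q i → i - (+ 4 * p - q + 1ℤ) + (+ 3 * p - q) + p ≡ i - 1ℤ
        rearr = solve-∀
      crossing→1≤P : ∀ ε′ u v → entersWith ε′ (X u) (X v) ≡ true → 1ℤ ≤ P X
      crossing→1≤P ε′ u v enters with X u in Xu | X v in Xv
      crossing→1≤P true  u v _  | false | true  = P-positive X Xv Xu
      crossing→1≤P false u v _  | true  | false = P-positive X Xu Xv
      crossing→1≤P true  u v () | true  | true
      crossing→1≤P false u v () | true  | true
      crossing→1≤P true  u v () | false | false
      crossing→1≤P false u v () | false | false
      crossing→1≤P true  u v () | true  | false
      crossing→1≤P false u v () | false | true
      1≤P : 1ℤ ≤ P X
      1≤P = let e , enters = some-entering in crossing→1≤P (ε e) (t e) (h e) (∧-trueʳ {both e} enters)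
      tight-eq : ∀ p q i b → i - (+ 4 * p - q + 1ℤ) + (b - i) + (+ 2 - b) ≡ 1ℤ - (+ 4 * p - q)
      tight-eq = solve-∀
      both-eq : ∀ p q i b → i - (+ 4 * p - q + 1ℤ) + (+ 3 * p - q) + (p - 1ℤ) + (b - i) ≡ b - + 2
      both-eq = solve-∀
      -- With `P ≥ 1` the count of entering common edges rises to at least 2, and there are at most
      -- two common edges at all.
      none-left : total entering-combination ≤ 0ℤ
      none-left = ungap (by (rearr (P X) (Q X) (entering-count X) B) (gap over ⊞ Q≤3P X ⊞ gap 1≤P ⊞ gap both≤2))
        where
        rearr : ∀ p q i b → i - (+ 4 * p - q + 1ℤ) + (+ 3 * p - q) + (p - 1ℤ) + (+ 2 - b) ≡ 0ℤ - (1ℤ * b + (-1ℤ * i + 0ℤ))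
        rearr = solve-∀
      all-enter : ∀ b i → 1ℤ * ⟦ b ⟧ + (-1ℤ * ⟦ b ∧ i ⟧ + 0ℤ) ≡ 0ℤ → b ≡ true → i ≡ true
      all-enter true true _ _ = refl
      enter : ∀ e → both e ≡ true → entering ε X e ≡ true
      enter e = all-enter (both e) (entering ε X e) (at-zero entering-combination (entering≤both X) none-left e)

    flow-or-bad : NowhereZeroFlow G 5 ⊎ ∃ (Bad ε)
    flow-or-bad = Sum.map
      (λ { (z , z-bounded , z-net) → circulation→flow G (direction ε) z z-bounded z-net })
      (λ { (X , violated) → X , violated→bad X violated })
      (hoffman (∑-0 (λ _ → refl)) (λ e → lower≤upper (direction ε e)))
      where
      lower≤upper : ∀ d → lower d ≤ upper d
      lower≤upper true  = +≤+ (s≤s z≤n)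
      lower≤upper false = -≤- z≤n

  enters⇒ : ∀ ε {a c} → entersWith ε a c ≡ true → a ≡ not ε × c ≡ ε
  enters⇒ true  {false} {true}  _ = refl , refl
  enters⇒ false {true}  {false} _ = refl , refl

  -- Failure of all four orientations

  module Contradiction (e₁ e₂ : Edge) (both₁ : both e₁ ≡ true) (both₂ : both e₂ ≡ true) (e₁≢e₂ : e₁ ≢ e₂)
    {X₁ X₂ X₃ X₄ : VertexSet}
    (bad₁ : Bad (λ _ → true) X₁) (bad₂ : Bad (e₁ ==_) X₂) (bad₃ : Bad (λ e → not (e₁ == e)) X₃) (bad₄ : Bad (λ _ → false) X₄) where

    ≢⇒== : ∀ {e} → e ≢ e₁ → e₁ == e ≡ false
    ≢⇒== {e} e≢ with e₁ ≟ e
    ... | yes eq = contradiction (sym eq) e≢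
    ... | no _   = refl

    sides : ∀ {ε X} → Bad ε X → ∀ e → both e ≡ true → ∀ {σ} → ε e ≡ σ → X (t e) ≡ not σ × X (h e) ≡ σ
    sides {ε} bad e be refl = enters⇒ (ε e) (Bad.enter bad e be)

    -- An edge that enters `X` by one end and `Y` by the other has one end in each difference. So
    -- both ends lie in the union and neither in the intersection.
    others : ∀ {X Y σ} e → X (t e) ≡ not σ × X (h e) ≡ σ → Y (t e) ≡ σ × Y (h e) ≡ not σ →
      crosses (X ∩′ Y) e ≡ false × crosses (X ∪′ Y) e ≡ false
    others {X} {Y} {σ} e (a , b) (c , d) rewrite a | b | c | d with σ
    ... | true  = refl , refl
    ... | false = refl , refl

    self : e₁ == e₁ ≡ true
    self = ==-refl e₁

    other : ∀ {e} → e ≢ e₁ → not (e₁ == e) ≡ true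
    other e≢ = cong not (≢⇒== e≢)

    at₁ : ∀ {ε X} → Bad ε X → ∀ {σ} → ε e₁ ≡ σ → X (t e₁) ≡ not σ × X (h e₁) ≡ σ
    at₁ bad = sides bad e₁ both₁

    at₂ : ∀ {ε X} → Bad ε X → ∀ {σ} → ε e₂ ≡ σ → X (t e₂) ≡ not σ × X (h e₂) ≡ σ
    at₂ bad = sides bad e₂ both₂

    e₂≢e₁ : e₂ ≢ e₁
    e₂≢e₁ eq = e₁≢e₂ (sym eq)

    pair : ∀ {a b c d : Set} → a × b → c × d → (a × c) × (b × d)
    pair (a , b) (c , d) = (a , c) , (b , d)

    first₁₂ = pair (at₁ bad₁ refl) (at₁ bad₂ self)
    second₁₂ = pair (at₂ bad₁ refl) (at₂ bad₂ (≢⇒== e₂≢e₁))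
    first₃₄ = pair (at₁ bad₃ (cong not self)) (at₁ bad₄ refl)
    second₃₄ = pair (at₂ bad₃ (other e₂≢e₁)) (at₂ bad₄ refl)

    module U = Uncross X₁ X₂ (Bad.tight bad₁) (Bad.tight bad₂) e₁
      (λ e be e≢ → others {X₁} {X₂} e (sides bad₁ e be refl) (sides bad₂ e be (≢⇒== e≢)))
      {p = h e₁} {q = h e₂} {r = t e₂} {s = t e₁}
      (proj₂ first₁₂) (proj₂ second₁₂) (proj₁ second₁₂) (proj₁ first₁₂)

    module V = Uncross X₃ X₄ (Bad.tight bad₃) (Bad.tight bad₄) e₁
      (λ e be e≢ → others {X₃} {X₄} e (sides bad₃ e be (other e≢)) (sides bad₄ e be refl))
      {p = t e₁} {q = h e₂} {r = t e₂} {s = h e₁}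
      (proj₁ first₃₄) (proj₂ second₃₄) (proj₁ second₃₄) (proj₂ first₃₄)

    -- `X₁` and `X₂` contain `h e₁`, while `X₃` and `X₄` do not; hence `A` and `A′` share this
    -- vertex.
    A A′ I : VertexSet
    A = U.A
    A′ = complement V.B
    I = A ∩′ A′

    I-h : I (h e₁) ≡ true
    I-h = cong₂ (λ a b → a ∧ not b) U.Ap V.Bs

    neither-outside : ∀ e → neither e ≡ true → crosses I e ≡ false
    neither-outside e ne = helper (A (t e)) (A (h e)) (V.B (t e)) (V.B (h e)) (U.TA.neither-inside e ne) (V.TB.neither-inside e ne)
      where
      helper : ∀ a c a′ c′ → a xor c ≡ false → a′ xor c′ ≡ false → (a ∧ not a′) xor (c ∧ not c′) ≡ false
      helper true  true  true  true  _ _ = refl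
      helper true  true  false false _ _ = refl
      helper false false _     _     _ _ = refl

    touching : (Edge → Bool) → Edge → ℤ
    touching c e = ⟦ c e ⟧ * (⟦ I (t e) ⟧ + ⟦ I (h e) ⟧)

    ∑-touching : ∀ c → (∀ v → deg (λ e → ⟦ c e ⟧) v ≡ 1ℤ) → ∑ (touching c) ≡ card I
    ∑-touching c deg≡1 = trans (sym (deg-pairing (λ e → ⟦ c e ⟧) (λ v → ⟦ I v ⟧)))
      (∑-cong (λ v → trans (cong (_*_ ⟦ I v ⟧) (deg≡1 v)) (ℤ.*-identityʳ ⟦ I v ⟧)))

    1≤touching-both : 1ℤ ≤ ∑ (touching both)
    1≤touching-both = ≤-trans at-e₁ (term≤∑ nonneg e₁)
      where
      nonneg : ∀ e → 0ℤ ≤ touching both e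
      nonneg e with both e | I (t e) | I (h e)
      ... | true  | true  | true  = +≤+ z≤n
      ... | true  | true  | false = +≤+ z≤n
      ... | true  | false | true  = +≤+ z≤n
      ... | true  | false | false = +≤+ z≤n
      ... | false | true  | true  = +≤+ z≤n
      ... | false | true  | false = +≤+ z≤n
      ... | false | false | true  = +≤+ z≤n
      ... | false | false | false = +≤+ z≤n
      at-e₁ : 1ℤ ≤ touching both e₁
      at-e₁ = helper (both e₁) (I (t e₁)) (I (h e₁)) both₁ I-h
        where
        helper : ∀ b a c → b ≡ true → c ≡ true → 1ℤ ≤ ⟦ b ⟧ * (⟦ a ⟧ + ⟦ c ⟧)
        helper true true  true _ _ = +≤+ (s≤s z≤n)
        helper true false true _ _ = +≤+ (s≤s z≤n)

    -- Every vertex has an edge outside both 1-factors, and the vertex h e₁ has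
    -- two.  None of these edges leaves I.
    cut-I : cut I + 1ℤ ≤ card I + card I
    cut-I = ungap (by collect (total-nonneg c pointwise ⊞ gap 1≤touching-both))
      where
      c : Combination size
      -- Inclusion-exclusion counts the ends in `I` of the edges of M₁ ∪ M₂, among which are all
      -- edges crossing `I`. The ends of the common edges are subtracted, and `e₁` provides at least
      -- one.
      c = (1ℤ , touching m₁) ∷ (1ℤ , touching m₂) ∷ (-1ℤ , touching both) ∷ (-1ℤ , λ e → ⟦ crosses I e ⟧) ∷ []
      helper : ∀ p q a c → (not p ∧ not q ≡ true → a xor c ≡ false) →
        0ℤ ≤ 1ℤ * (⟦ p ⟧ * (⟦ a ⟧ + ⟦ c ⟧)) + (1ℤ * (⟦ q ⟧ * (⟦ a ⟧ + ⟦ c ⟧)) + (-1ℤ * (⟦ p ∧ q ⟧ * (⟦ a ⟧ + ⟦ c ⟧)) + (-1ℤ * ⟦ a xor c ⟧ + 0ℤ)))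
      helper = from-yes (∀-Bool? λ p → ∀-Bool? λ q → ∀-Bool? λ a → ∀-Bool? λ c →
        ((not p ∧ not q Bool.≟ true) →-dec (a xor c Bool.≟ false)) →-dec
        (0ℤ ℤ.≤? 1ℤ * (⟦ p ⟧ * (⟦ a ⟧ + ⟦ c ⟧)) + (1ℤ * (⟦ q ⟧ * (⟦ a ⟧ + ⟦ c ⟧)) + (-1ℤ * (⟦ p ∧ q ⟧ * (⟦ a ⟧ + ⟦ c ⟧)) + (-1ℤ * ⟦ a xor c ⟧ + 0ℤ)))))
      pointwise : ∀ e → 0ℤ ≤ at c e
      pointwise e = helper (m₁ e) (m₂ e) (I (t e)) (I (h e)) (neither-outside e)
      rearr : ∀ k b d → 1ℤ * k + (1ℤ * k + (-1ℤ * b + (-1ℤ * d + 0ℤ))) + (b - 1ℤ) ≡ k + k - (d + 1ℤ)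
      rearr = solve-∀
      collect : total c + (∑ (touching both) - 1ℤ) ≡ card I + card I - (cut I + 1ℤ)
      collect = trans (cong₂ (λ k k′ → 1ℤ * k + (1ℤ * k′ + (-1ℤ * ∑ (touching both) + (-1ℤ * cut I + 0ℤ))) + (∑ (touching both) - 1ℤ))
        (∑-touching m₁ deg-m₁) (∑-touching m₂ deg-m₂)) (rearr (card I) (∑ (touching both)) (cut I))

    I⊆A : ∀ v → I v ≡ true → A v ≡ true
    I⊆A v = ∧-trueˡ

    -- `I` induces a forest because `A` does, so `card I + 2 ≤ cut I ≤ 2 * card I - 1`.
    3≤card-I : + 3 ≤ card I
    3≤card-I = [ (λ circuit → ⊥-elim (proj₁ U.side-A (HasCircuit-mono I⊆A circuit))) , bound ]′ (circuit-or-small I (cut I) ≤-refl (h e₁) I-h)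
      where
      bound : card I + + 2 ≤ cut I → + 3 ≤ card I
      bound p = ungap (by (rearr (card I) (cut I)) (gap p ⊞ gap cut-I))
        where
        rearr : ∀ k d → d - (k + + 2) + (k + k - (d + 1ℤ)) ≡ k - + 3
        rearr = solve-∀

    fills : ∀ (S : VertexSet) → (∀ v → ⟦ I v ⟧ ≤ ⟦ S v ⟧) → card S ≤ + 3 → ∀ v → S v ≡ I v
    fills S I≤S card≤3 v = ⟦⟧-injective (ℤ.i-j≡0⇒i≡j ⟦ S v ⟧ ⟦ I v ⟧
      (trans (sym (rearr ⟦ S v ⟧ ⟦ I v ⟧)) (at-zero c pointwise small v)))
      where
      rearr : ∀ s i → 1ℤ * s + (-1ℤ * i + 0ℤ) ≡ s - i
      rearr = solve-∀
      c : Combination order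
      c = (1ℤ , λ v → ⟦ S v ⟧) ∷ (-1ℤ , λ v → ⟦ I v ⟧) ∷ []
      pointwise : ∀ v → 0ℤ ≤ at c v
      pointwise v = by (sym (rearr ⟦ S v ⟧ ⟦ I v ⟧)) (gap (I≤S v))
      small : total c ≤ 0ℤ
      small = ≤-trans (≤-reflexive (rearr (card S) (card I))) (ℤ.i≤j⇒i-j≤0 (≤-trans card≤3 3≤card-I))

    A≡A′ : ∀ v → A v ≡ A′ v
    A≡A′ v = trans (fills A below (proj₂ U.side-A) v) (sym (fills A′ below′ (proj₂ V.side-B) v))
      where
      below : ∀ v → ⟦ I v ⟧ ≤ ⟦ A v ⟧
      below v with A v | A′ v
      ... | true  | true  = ≤-refl
      ... | true  | false = +≤+ z≤n
      ... | false | _     = ≤-refl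
      below′ : ∀ v → ⟦ I v ⟧ ≤ ⟦ A′ v ⟧
      below′ v with A v | A′ v
      ... | true  | true  = ≤-refl
      ... | true  | false = ≤-refl
      ... | false | true  = +≤+ z≤n
      ... | false | false = ≤-refl

    -- Complementing exchanges entering and leaving edges, so the three edges entering `A` would be
    -- the single edge leaving `V.B`.
    absurd : ⊥
    absurd = contradiction (trans (sym U.TA.Q≡3) (trans Q≡P V.TB.P≡1)) λ ()
      where
      Q≡P : Q A ≡ P V.B
      Q≡P = ∑-cong (λ e → cong ⟦_⟧ (trans (cong₂ (enters (m₁ e) (m₂ e) (x e) (y e)) (A≡A′ (t e)) (A≡A′ (h e)))
        (enters-complement (m₁ e) (m₂ e) (x e) (y e) (V.B (t e)) (V.B (h e)))))

  -- Trying the four orientations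

  two-common-edges : + 2 ≤ ∑ (λ e → ⟦ both e ⟧) → ∃ λ e₁ → ∃ λ e₂ → both e₁ ≡ true × both e₂ ≡ true × e₁ ≢ e₂
  two-common-edges 2≤both =
    let e₁ , both₁ = some-true both (≤-trans (+≤+ (s≤s z≤n)) 2≤both)
        e₂ , both₂ = some-true (λ e → both e ∧ not (e₁ == e)) (rest e₁)
    in e₁ , e₂ , both₁ , ∧-trueˡ both₂ , distinct e₁ e₂ (∧-trueʳ {both e₂} both₂)
    where
    distinct : ∀ e₁ e₂ → not (e₁ == e₂) ≡ true → e₁ ≢ e₂
    distinct e₁ .e₁ p refl = contradiction (trans (sym p) (cong not (==-refl e₁))) λ ()
    rest : ∀ e₁ → 1ℤ ≤ ∑ (λ e → ⟦ both e ∧ not (e₁ == e) ⟧)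
    rest e₁ = ungap (by (collect (∑ (λ e → ⟦ both e ⟧)) (∑ (λ e → ⟦ both e ∧ not (e₁ == e) ⟧)) (∑-δ e₁))
      (gap 2≤both ⊞ total-nonneg c pointwise))
      where
      c : Combination size
      c = (1ℤ , λ e → ⟦ both e ∧ not (e₁ == e) ⟧) ∷ (1ℤ , λ e → ⟦ e₁ == e ⟧) ∷ (-1ℤ , λ e → ⟦ both e ⟧) ∷ []
      pointwise : ∀ e → 0ℤ ≤ at c e
      pointwise e with both e | e₁ == e
      ... | true  | true  = +≤+ z≤n
      ... | true  | false = +≤+ z≤n
      ... | false | true  = +≤+ z≤n
      ... | false | false = +≤+ z≤n
      collect : ∀ b r {d} → d ≡ 1ℤ → b - + 2 + (1ℤ * r + (1ℤ * d + (-1ℤ * b + 0ℤ))) ≡ r - 1ℤ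
      collect b r refl = rearr b r
        where
        rearr : ∀ b r → b - + 2 + (1ℤ * r + (1ℤ * 1ℤ + (-1ℤ * b + 0ℤ))) ≡ r - 1ℤ
        rearr = solve-∀

  five-flow : NowhereZeroFlow G 5
  five-flow = [ id , first ]′ (flow-or-bad (λ _ → true))
    where
    first : ∃ (Bad (λ _ → true)) → NowhereZeroFlow G 5
    first (X₁ , bad₁) =
      -- The failure of the first orientation supplies the two common edges; if there are fewer,
      -- that orientation already carries a flow.
      let e₁ , e₂ , both₁ , both₂ , e₁≢e₂ = two-common-edges (Bad.2≤both bad₁)
      in [ id , (λ { (X₂ , bad₂) →
         [ id , (λ { (X₃ , bad₃) →
         [ id , (λ { (X₄ , bad₄) → ⊥-elim (Contradiction.absurd e₁ e₂ both₁ both₂ e₁≢e₂ bad₁ bad₂ bad₃ bad₄) })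
         ]′ (flow-or-bad (λ _ → false)) })
         ]′ (flow-or-bad (λ e → not (e₁ == e))) })
         ]′ (flow-or-bad (e₁ ==_))

theorem1p2 : (G : Graph) → Cubic G → CyclicallyEdgeConnected G 6 →
    (μ : ℕ) → Isμ₂ G μ → μ ℕ.≤ 2 → NowhereZeroFlow G 5
theorem1p2 G cubic connected μ ((M₁ , M₂ , M₁-factor , M₂-factor , refl) , _) μ≤2 =
  FiveFlow.five-flow G cubic connected M₁ M₂ M₁-factor M₂-factor μ≤2
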